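{- Let $\Gamma$ be a finite simple undirected graph with spanning tree $T$, base vertex $v_0$, cotree edges $e_1,\dots,e_t$ with chosen arcs, and basic closed walks $L_1,\dots,L_t$ as in the context. Let $A=\prod_{\gamma=1}^{g}\prod_{\eta=1}^{a_\gamma}\mathbb{Z}/p_\gamma^{k(\gamma,\eta)}$ with $p_1,\dots,p_g$ distinct primes and $k(\gamma,1)\le\cdots\le k(\gamma,a_\gamma)$ for each $\gamma$, and let $\phi$ be a $T$-reduced $A$-voltage assignment on $\Gamma$. Let $\alpha\in Aut(\Gamma)$ with matrix $S^\alpha\in GL(t,\mathbb{Z})$ on $H_1(\Gamma;\mathbb{Z})$, and let $R_\gamma$, $B_\gamma$ be as in the context. For each $\gamma\in\{1,\dots,g\}$, let $Q_\gamma\in GL(t,R_\gamma)$, $T_\gamma\in GL(a_\gamma,R_\gamma)$ be such that $B^0_\gamma=Q_\gamma B_\gamma T_\gamma$ is in normal form, $(B^0_\gamma)_{i,j}=\delta_{i,j}p_\gamma^{s_{\gamma,i}}$, and let $i_{\gamma,0}$ be the smallest $i$ with $s_{\gamma,i}>0$. Then $\alpha$ can be lifted to an automorphism of $\Gamma\times_\phi A$ if and only if for each $\gamma$, $$d_{p_\gamma}\big((Q_\gamma S^\alpha Q_\gamma^{ -1})_{i,j}\big)\geqslant s_{\gamma,i}-s_{\gamma,j}\quad\text{for all } i>j,$$ where $S^\alpha$ is regarded as a matrix over $R_\gamma$ by reduction of its entries.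
   Context: Graphs are finite, simple and undirected; each edge $\{u,v\}$ gives two opposite arcs $(u,v),(v,u)$. Abelian groups are written additively. An $A$-voltage assignment is a function $\phi$ from arcs to $A$ with $\phi(v,u)=-\phi(u,v)$; it extends to walks by summing voltages of traversed arcs. The derived graph $\Gamma\times_{\phi}A$ has vertex set $V(\Gamma)\times A$ and edges $\{(u,g),(v,\phi(u,v)+g)\}$ for $\{u,v\}\in E(\Gamma)$, $g\in A$; $\pi$ is the first-coordinate projection. $\alpha\in Aut(\Gamma)$ lifts if there is $\tilde\alpha\in Aut(\Gamma\times_\phi A)$ with $\pi\tilde\alpha=\alpha\pi$. For a spanning tree $T$, $\phi$ is $T$-reduced if all tree arcs have voltage $0$. Fix a vertex $v_0$; $W(x,y)$ is the unique reduced walk in $T$ from $x$ to $y$. For each cotree edge $e_i$ ($1\le i\le t$) an arc $h(e_i)=(u_i,v_i)$ is chosen and $L_i=W(v_0,u_i)\,h(e_i)\,W(v_i,v_0)$; the classes of $L_1,\dots,L_t$ form a basis of $H_1(\Gamma;\mathbb{Z})\cong\mathbb{Z}^t$, and $S^\alpha$ is defined by $\alpha_*(L_i)=\sum_j(S^\alpha)_{i,j}L_j$. Write $\theta_i=\phi(L_i)=(\theta_i^{(1)},\dots,\theta_i^{(g)})$ with $\theta_i^{(\gamma)}=(\theta_i^{(\gamma)}(1),\dots,\theta_i^{(\gamma)}(a_\gamma))$, $\theta_i^{(\gamma)}(\eta)\in\mathbb{Z}/p_\gamma^{k(\gamma,\eta)}$. Let $R_\gamma=\mathbb{Z}/p_\gamma^{k(\gamma,a_\gamma)}$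 and define $B_\gamma\in\mathcal{M}_{t\times a_\gamma}(R_\gamma)$ by $(B_\gamma)_{i,j}=p_\gamma^{k(\gamma,a_\gamma)-k(\gamma,j)}\,\theta_i^{(\gamma)}(j)$. For a prime $p$ and $R=\mathbb{Z}/p^k$: for $0\ne\lambda\in R$, $d_p(\lambda)$ is the largest $r$ with $0\le r<k$ and $p^r\mid\lambda$, and $d_p(0)=k$; a nonzero $Y\in\mathcal{M}_{m\times n}(R)$ is in normal form if $Y_{i,j}=\delta_{i,j}p^{r_i}$ with $0\le r_1\le\cdots\le r_l<k=r_{l+1}=\cdots=r_m$ for some $l\le\min\{m,n\}$. -}

module Defs where

open import Data.Nat as ℕ using (ℕ; zero; suc; _≤_; _<_; _∸_; _^_; _≡ᵇ_)
open import Data.Nat.Divisibility using (_∣?_)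
open import Data.Nat.Primality using (Prime)
open import Data.Integer as ℤ using (ℤ; +_; ∣_∣)
open import Data.Integer.Divisibility renaming (_∣_ to _∣ℤ_)
open import Data.Fin using (Fin; toℕ; fromℕ; zero; suc)
open import Data.List using (List; []; _∷_; _++_; map; length; foldr)
open import Data.List.Relation.Unary.All using (All)
open import Data.List.Relation.Unary.Unique.Propositional using (Unique)
open import Data.Bool using (Bool; true; false; if_then_else_; _∧_)
open import Data.Product using (Σ; ∃; _×_; _,_; proj₁; proj₂)
open import Data.Sum using (_⊎_)
open import Data.Unit using (⊤)
open import Relation.Binary.PropositionalEquality using (_≡_)
open import Relation.Nullary using (¬_; does)
open import Data.Fin.Permutation using (Permutation′; _⟨$⟩ʳ_)

record Graph (n : ℕ) : Set where
  field
    Adj        : Fin n → Fin n → Bool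
    Adj-sym    : ∀ u v → Adj u v ≡ Adj v u
    Adj-irrefl : ∀ v → Adj v v ≡ false
open Graph public

IsAut : ∀ {n} → Graph n → Permutation′ n → Set
IsAut Γ α = ∀ u v → Adj Γ (α ⟨$⟩ʳ u) (α ⟨$⟩ʳ v) ≡ Adj Γ u v

record Walk (n : ℕ) : Set where
  constructor walk
  field
    start : Fin n
    rest  : List (Fin n)
open Walk public

lastV : ∀ {n} → Fin n → List (Fin n) → Fin n
lastV x []       = x
lastV x (y ∷ ys) = lastV y ys

endV : ∀ {n} → Walk n → Fin n
endV w = lastV (start w) (rest w)

arcsFrom : ∀ {n} → Fin n → List (Fin n) → List (Fin n × Fin n)
arcsFrom x []       = []
arcsFrom x (y ∷ ys) = (x , y) ∷ arcsFrom y ys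

arcsW : ∀ {n} → Walk n → List (Fin n × Fin n)
arcsW w = arcsFrom (start w) (rest w)

IsWalkIn : ∀ {n} → (Fin n → Fin n → Bool) → Walk n → Set
IsWalkIn E w = All (λ e → E (proj₁ e) (proj₂ e) ≡ true) (arcsW w)

NoBacktrack : ∀ {n} → Fin n → List (Fin n) → Set
NoBacktrack x []           = ⊤
NoBacktrack x (y ∷ [])     = ⊤
NoBacktrack x (y ∷ z ∷ zs) = ¬ (x ≡ z) × NoBacktrack y (z ∷ zs)

IsReduced : ∀ {n} → Walk n → Set
IsReduced w = NoBacktrack (start w) (rest w)

mapWalk : ∀ {n} → (Fin n → Fin n) → Walk n → Walk n
mapWalk f w = walk (f (start w)) (map f (rest w))

IsCycleIn : ∀ {n} → (Fin n → Fin n → Bool) → Walk n → Set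
IsCycleIn E w = IsWalkIn E w × endV w ≡ start w × 3 ≤ length (rest w) × Unique (rest w)

record IsSpanningTree {n} (Γ : Graph n) (Tr : Fin n → Fin n → Bool) : Set where
  field
    sub       : ∀ u v → Tr u v ≡ true → Adj Γ u v ≡ true
    Tr-sym    : ∀ u v → Tr u v ≡ Tr v u
    connected : ∀ x y → Σ (Walk n) λ w → start w ≡ x × endV w ≡ y × IsWalkIn Tr w
    acyclic   : ∀ w → ¬ IsCycleIn Tr w

IsTreeWalk : ∀ {n} → (Fin n → Fin n → Bool) → Fin n → Fin n → Walk n → Set
IsTreeWalk Tr x y w = start w ≡ x × endV w ≡ y × IsWalkIn Tr w × IsReduced w

record IsCotreeArcs {n t} (Γ : Graph n) (Tr : Fin n → Fin n → Bool)
                    (h : Fin t → Fin n × Fin n) : Set where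
  field
    isEdge   : ∀ i → Adj Γ (proj₁ (h i)) (proj₂ (h i)) ≡ true
    notTree  : ∀ i → Tr (proj₁ (h i)) (proj₂ (h i)) ≡ false
    distinct : ∀ i j → (h j ≡ h i ⊎ h j ≡ (proj₂ (h i) , proj₁ (h i))) → i ≡ j
    covers   : ∀ u v → Adj Γ u v ≡ true → Tr u v ≡ false →
               ∃ λ i → h i ≡ (u , v) ⊎ h i ≡ (v , u)

basicWalk : ∀ {n t} → Fin n → (Fin n → Fin n → Walk n) →
            (Fin t → Fin n × Fin n) → Fin t → Walk n
basicWalk v₀ W h i =
  walk v₀ (rest (W v₀ (proj₁ (h i))) ++ (proj₂ (h i) ∷ rest (W (proj₂ (h i)) v₀)))

sumℤ : (m : ℕ) → (Fin m → ℤ) → ℤ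
sumℤ zero    f = + 0
sumℤ (suc m) f = f zero ℤ.+ sumℤ m (λ i → f (suc i))

Cong : ℕ → ℤ → ℤ → Set
Cong N x y = (+ N) ∣ℤ (x ℤ.- y)

eqᵇ : ∀ {m n} → Fin m → Fin n → Bool
eqᵇ i j = toℕ i ≡ᵇ toℕ j

-- 1-chain of a walk: (u,v) ↦ #traversals of (u,v) − #traversals of (v,u).
-- For graphs H₁(Γ;ℤ) is the cycle space inside C₁, so homology classes of
-- closed walks are exactly these chains.
chainW : ∀ {n} → Walk n → Fin n → Fin n → ℤ
chainW w u v = foldr (λ e acc → acc ℤ.+ contrib e) (+ 0) (arcsW w)
  where
  contrib : _ → ℤ
  contrib (a , b) = (if eqᵇ a u ∧ eqᵇ b v then + 1 else + 0)
                    ℤ.- (if eqᵇ a v ∧ eqᵇ b u then + 1 else + 0)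

-- The group A = ∏_γ ∏_{η} ℤ/p_γ^{k(γ,η)}   (a_γ = suc (a γ) factors)
-- elements are represented by integer tuples, equality is congruence.

record Shape : Set where
  field
    g : ℕ
    a : Fin g → ℕ                       -- a_γ = suc (a γ)
    p : Fin g → ℕ
    k : (γ : Fin g) → Fin (suc (a γ)) → ℕ
open Shape public

record IsPrimaryShape (σ : Shape) : Set where
  field
    prime    : ∀ γ → Prime (p σ γ)
    distinct : ∀ γ δ → p σ γ ≡ p σ δ → γ ≡ δ
    mono     : ∀ γ η η' → toℕ η ≤ toℕ η' → k σ γ η ≤ k σ γ η'
    pos      : ∀ γ η → 1 ≤ k σ γ η

Elt : Shape → Set
Elt σ = (γ : Fin (g σ)) → Fin (suc (a σ γ)) → ℤ

EqA : ∀ σ → Elt σ → Elt σ → Set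
EqA σ x y = ∀ γ η → Cong (p σ γ ^ k σ γ η) (x γ η) (y γ η)

addA : ∀ σ → Elt σ → Elt σ → Elt σ
addA σ x y γ η = x γ η ℤ.+ y γ η

negA : ∀ σ → Elt σ → Elt σ
negA σ x γ η = ℤ.- x γ η

zeroA : ∀ σ → Elt σ
zeroA σ γ η = + 0

-- K_γ = k(γ, a_γ), so R_γ = ℤ/p_γ^{K_γ}
Kγ : (σ : Shape) → Fin (g σ) → ℕ
Kγ σ γ = k σ γ (fromℕ (a σ γ))

-- Voltage assignments (values on non-adjacent pairs are irrelevant)

record Voltage (n : ℕ) (σ : Shape) : Set where
  constructor voltage
  field vol : Fin n → Fin n → Elt σ
open Voltage public

IsVoltage : ∀ {n σ} → Graph n → Voltage n σ → Set
IsVoltage {σ = σ} Γ φ = ∀ u v → Adj Γ u v ≡ true → EqA σ (vol φ v u) (negA σ (vol φ u v))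

IsTReduced : ∀ {n σ} → (Fin n → Fin n → Bool) → Voltage n σ → Set
IsTReduced {σ = σ} Tr φ = ∀ u v → Tr u v ≡ true → EqA σ (vol φ u v) (zeroA σ)

voltW : ∀ {n σ} → Voltage n σ → Walk n → Elt σ
voltW {σ = σ} φ w = foldr (λ e acc → addA σ (vol φ (proj₁ e) (proj₂ e)) acc) (zeroA σ) (arcsW w)

EqV : ∀ {n} σ → Fin n × Elt σ → Fin n × Elt σ → Set
EqV σ (u , x) (v , y) = u ≡ v × EqA σ x y

DAdj : ∀ {n σ} → Graph n → Voltage n σ → Fin n × Elt σ → Fin n × Elt σ → Set
DAdj {σ = σ} Γ φ (u , x) (v , y) = Adj Γ u v ≡ true × EqA σ y (addA σ (vol φ u v) x)

record DerivedAut {n σ} (Γ : Graph n) (φ : Voltage n σ) : Set where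
  field
    f      : Fin n × Elt σ → Fin n × Elt σ
    f⁻¹    : Fin n × Elt σ → Fin n × Elt σ
    f-cong   : ∀ x y → EqV σ x y → EqV σ (f x) (f y)
    f⁻¹-cong : ∀ x y → EqV σ x y → EqV σ (f⁻¹ x) (f⁻¹ y)
    invˡ   : ∀ x → EqV σ (f⁻¹ (f x)) x
    invʳ   : ∀ x → EqV σ (f (f⁻¹ x)) x
    adj⇒   : ∀ x y → DAdj Γ φ x y → DAdj Γ φ (f x) (f y)
    adj⇐   : ∀ x y → DAdj Γ φ (f x) (f y) → DAdj Γ φ x y
open DerivedAut public

Lifts : ∀ {n σ} → Graph n → Voltage n σ → Permutation′ n → Set
Lifts Γ φ α = Σ (DerivedAut Γ φ) λ F → ∀ x → proj₁ (f F x) ≡ α ⟨$⟩ʳ proj₁ x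

-- Matrices (integer representatives, read modulo N)

Mat : ℕ → ℕ → Set
Mat m n = Fin m → Fin n → ℤ

_·_ : ∀ {l m r} → Mat l m → Mat m r → Mat l r
_·_ {m = m} X Y i j = sumℤ m (λ q → X i q ℤ.* Y q j)

idM : ∀ m → Mat m m
idM m i j = if eqᵇ i j then + 1 else + 0

IsInvPair : ℕ → ∀ m → Mat m m → Mat m m → Set
IsInvPair N m X Y = ∀ i j → Cong N ((X · Y) i j) (idM m i j) × Cong N ((Y · X) i j) (idM m i j)

IsHomologyMatrix : ∀ {n t} → Permutation′ n → (Fin t → Walk n) → Mat t t → Set
IsHomologyMatrix {t = t} α L S =
  ∀ i u v → chainW (mapWalk (α ⟨$⟩ʳ_) (L i)) u v ≡ sumℤ t (λ j → S i j ℤ.* chainW (L j) u v)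

Bmat : ∀ {n t} (σ : Shape) → Voltage n σ → (Fin t → Walk n) →
       (γ : Fin (g σ)) → Mat t (suc (a σ γ))
Bmat σ φ L γ i j = (+ (p σ γ ^ (Kγ σ γ ∸ k σ γ j))) ℤ.* voltW φ (L i) γ j

-- d_p on ℤ/p^K (applied to an integer representative)
dpGo : ℕ → ℕ → ℕ → ℕ
dpGo p m zero    = 0
dpGo p m (suc r) = if does ((p ^ suc r) ∣? m) then suc r else dpGo p m r

dp : ℕ → ℕ → ℤ → ℕ
dp p K x = if does ((p ^ K) ∣? ∣ x ∣) then K else dpGo p ∣ x ∣ (K ∸ 1)

IsNormalForm : (p K m n : ℕ) → Mat m n → (Fin m → ℕ) → Set
IsNormalForm p K m n Y r =
  ¬ (∀ i j → Cong (p ^ K) (Y i j) (+ 0)) ×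
  Σ ℕ λ l → l ≤ m × l ≤ n ×
    (∀ i → toℕ i < l → r i < K) ×
    (∀ i → l ≤ toℕ i → r i ≡ K) ×
    (∀ i j → toℕ i ≤ toℕ j → r i ≤ r j) ×
    (∀ i j → Cong (p ^ K) (Y i j) (if eqᵇ i j then + (p ^ r i) else + 0))

{-# OPTIONS --safe #-}
module Submission where

-- A lift of α translates fibres compatibly with closed walks, so the automorphism S of ℤᵗ must
-- preserve the kernel of c ↦ Σ cᵢ θᵢ.  Conversely, if S preserves this kernel, it induces a map
-- Σ cᵢ θᵢ ↦ Σ (c S)ᵢ θᵢ of the local group; acting by it on every coset of the local group in A
-- (around a chosen representative) and correcting by the voltages of α W(v₀, u) gives a lift,
-- which is invertible because α has finite order.
--
-- By coprimality of the p_γ the kernel condition splits into the conditions that c ↦ c S preserves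
-- { c | c B_γ = 0 } over R_γ.  In the coordinates d = c Q⁻¹ this set becomes { d | dᵢ p^sᵢ = 0 for all i },
-- which is preserved by P = Q S Q⁻¹ exactly when p^K ∣ p^(K ∸ sᵢ) Pᵢⱼ p^sⱼ, that is d_p(Pᵢⱼ) ≥ sᵢ − sⱼ.

open import Defs
open import Data.Bool using (Bool; true; false; if_then_else_; T; _∧_)
open import Data.Bool.Properties using (if-eta; ∧-comm; ∧-zeroʳ)
open import Data.Fin using (Fin; toℕ; fromℕ; fromℕ<; zero; suc)
import Data.Fin.Properties as Fin
open import Data.Fin.Permutation using (Permutation′; _⟨$⟩ʳ_; _⟨$⟩ˡ_; inverseˡ; inverseʳ)
open import Data.Integer as ℤ using (ℤ; +_; -[1+_]; -_; _+_; _*_; _-_; 0ℤ; 1ℤ) renaming (∣_∣ to abs)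
open import Data.Integer.DivMod using (_%ℕ_; _/ℕ_; n%ℕd<d; a≡a%ℕn+[a/ℕn]*n)
open import Data.Integer.Divisibility.Signed using (∣ᵤ⇒∣; ∣⇒∣ᵤ; divides)
  renaming (_∣_ to _∣ₛ_; _∣?_ to _∣ₛ?_)
import Data.Integer.Divisibility.Signed as ∣ₛ
import Data.Integer.Properties as ℤ
open import Data.Integer.Tactic.RingSolver using (solve-∀)
open import Data.List using (List; []; _∷_; [_]; _++_; map; foldr; length; upTo; tabulate;
  cartesianProductWith)
import Data.List.Properties as List
open import Data.List.Membership.DecPropositional using (_∈?_)
open import Data.List.Membership.Propositional using (lose)
open import Data.List.Membership.Propositional.Properties using (∈-tabulate⁺; ∈-∃++; ∈-upTo⁺; ∈-map⁺)
open import Data.List.Relation.Unary.All as All using (All; []; _∷_)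
import Data.List.Relation.Unary.All.Properties as All
open import Data.List.Relation.Unary.AllPairs using ([]; _∷_)
open import Data.List.Relation.Unary.Any as Any using (Any; here; there)
import Data.List.Relation.Unary.Any.Properties as Any
open import Data.List.Relation.Unary.Unique.Propositional using (Unique)
open import Data.Nat as ℕ using (ℕ; zero; suc; _≤_; _<_; _∸_; _^_; z≤n; s≤s)
open import Data.Nat.Divisibility using (_∣_; _∣?_)
import Data.Nat.Divisibility as ∣
open import Data.Nat.GeneralisedArithmetic using (iterate)
open import Data.Nat.ListAction using (product)
open import Data.Nat.ListAction.Properties using (∈⇒∣product; product≢0)
open import Data.Nat.Primality using (Prime; prime⇒nonZero; prime⇒irreducible; euclidsLemma; ¬prime[1])
import Data.Nat.Properties as ℕ
open import Data.Product using (∃; _×_; _,_; proj₁; proj₂; swap)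
open import Data.Sum using (_⊎_; inj₁; inj₂; [_,_]′)
open import Data.Unit using (tt)
open import Function using (_∘_)
open import Function.Bundles using (_⇔_; mk⇔; Equivalence)
open import Function.Definitions using (Injective)
open import Level using (0ℓ)
open import Relation.Binary using (Rel; Setoid)
import Relation.Binary.Reasoning.Setoid as SetoidReasoning
open import Relation.Binary.PropositionalEquality
  using (_≡_; _≢_; _≗_; refl; sym; trans; cong; cong₂; subst; module ≡-Reasoning)
open import Relation.Nullary using (¬_; Dec; does; yes; no; contradiction)
import Relation.Nullary.Decidable as Dec
open import Relation.Unary using (Pred; Decidable)

-- The local group generated by the `θ i` need be neither all of A nor a direct factor of it, and
-- the map induced on it by `S` need not extend to an endomorphism of A. A lift only has to respect
-- translations by the local group, so each coset can be treated separately, at the price of a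
-- choice of base points. Elements of A are integer tuples up to congruence, so this choice must
-- give the identical tuple for all members of a coset; a decidable search through a finite list
-- provides it.
--
-- Homology enters through one principle: modulo N, the sum of an antisymmetric function along a
-- walk depends only on the chain of the walk. Applied to voltages pulled back along powers of `α`,
-- it identifies the rows of S^r θ with the voltages of the closed walks α^r Lᵢ. For r = 1 this
-- links `S` to fibre translations; for r a multiple of the order of `α` it shows that `S` acts with
-- finite order on combinations of the `θ i`, so the inverse of the lift is found by iteration.

private variable
  N l m n t : ℕ
  x x′ y y′ : ℤ
  X : Set

-- Congruences, sums and matrices

-- A record, so that the two sides can be recovered by unification (Cong reduces).
infix 4 _≡_[mod_]
record _≡_[mod_] (x y : ℤ) (N : ℕ) : Set where
  constructor congruent
  field difference : Cong N x y
open _≡_[mod_]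

∣⇒≡mod : + N ∣ₛ x - y → x ≡ y [mod N ]
∣⇒≡mod = congruent ∘ ∣⇒∣ᵤ

≡mod⇒∣ : x ≡ y [mod N ] → + N ∣ₛ x - y
≡mod⇒∣ = ∣ᵤ⇒∣ ∘ difference

≡⇒≡mod : x ≡ y → x ≡ y [mod N ]
≡⇒≡mod {x} refl = ∣⇒≡mod (divides 0ℤ (ℤ.+-inverseʳ x))

≡mod-refl : x ≡ x [mod N ]
≡mod-refl = ≡⇒≡mod refl

≡mod-sym : x ≡ y [mod N ] → y ≡ x [mod N ]
≡mod-sym {x} {y} e = ∣⇒≡mod (subst (_ ∣ₛ_) (lemma x y) (∣ₛ.∣m⇒∣-m (≡mod⇒∣ e)))
  where
  lemma : ∀ x y → - (x - y) ≡ y - x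
  lemma = solve-∀

≡mod-trans : {x y z : ℤ} → x ≡ y [mod N ] → y ≡ z [mod N ] → x ≡ z [mod N ]
≡mod-trans {x = x} {y} {z} e f =
  ∣⇒≡mod (subst (_ ∣ₛ_) (lemma x y z) (∣ₛ.∣m∣n⇒∣m+n (≡mod⇒∣ e) (≡mod⇒∣ f)))
  where
  lemma : ∀ x y z → (x - y) + (y - z) ≡ x - z
  lemma = solve-∀

≡mod-setoid : ℕ → Setoid _ _
≡mod-setoid N = record
  { Carrier = ℤ ; _≈_ = _≡_[mod N ]
  ; isEquivalence = record { refl = ≡mod-refl ; sym = ≡mod-sym ; trans = ≡mod-trans } }

module ≡mod-Reasoning (N : ℕ) = SetoidReasoning (≡mod-setoid N)

+-cong-mod : x ≡ x′ [mod N ] → y ≡ y′ [mod N ] → x + y ≡ x′ + y′ [mod N ]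
+-cong-mod {x} {x′} {y = y} {y′} e f =
  ∣⇒≡mod (subst (_ ∣ₛ_) (lemma x x′ y y′) (∣ₛ.∣m∣n⇒∣m+n (≡mod⇒∣ e) (≡mod⇒∣ f)))
  where
  lemma : ∀ x x′ y y′ → (x - x′) + (y - y′) ≡ (x + y) - (x′ + y′)
  lemma = solve-∀

*-congˡ-mod : ∀ c → x ≡ y [mod N ] → c * x ≡ c * y [mod N ]
*-congˡ-mod {x} {y} c e = ∣⇒≡mod (subst (_ ∣ₛ_) (lemma c x y) (∣ₛ.∣n⇒∣m*n c (≡mod⇒∣ e)))
  where
  lemma : ∀ c x y → c * (x - y) ≡ c * x - c * y
  lemma = solve-∀

*-congʳ-mod : ∀ c → x ≡ y [mod N ] → x * c ≡ y * c [mod N ]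
*-congʳ-mod {x} {y} {N} c e rewrite ℤ.*-comm x c | ℤ.*-comm y c = *-congˡ-mod c e

neg-cong-mod : x ≡ y [mod N ] → - x ≡ - y [mod N ]
neg-cong-mod {x} {y} {N} e rewrite sym (ℤ.-1*i≡-i x) | sym (ℤ.-1*i≡-i y) = *-congˡ-mod (- 1ℤ) e

+-cancelˡ-mod : ∀ z → z + x ≡ z + y [mod N ] → x ≡ y [mod N ]
+-cancelˡ-mod {x} {y} z e = ∣⇒≡mod (subst (_ ∣ₛ_) (lemma x y z) (≡mod⇒∣ e))
  where
  lemma : ∀ x y z → (z + x) - (z + y) ≡ x - y
  lemma = solve-∀

≡mod-dec : ∀ N x y → Dec (x ≡ y [mod N ])
≡mod-dec N x y = Dec.map′ ∣⇒≡mod ≡mod⇒∣ (+ N ∣ₛ? x - y)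

≡0⇒∣abs : x ≡ 0ℤ [mod N ] → N ∣ abs x
≡0⇒∣abs {x} {N} e = subst (λ z → N ∣ abs z) (ℤ.+-identityʳ x) (difference e)

∣abs⇒≡0 : N ∣ abs x → x ≡ 0ℤ [mod N ]
∣abs⇒≡0 {N} {x} d = congruent (subst (λ z → N ∣ abs z) (sym (ℤ.+-identityʳ x)) d)

eqᵇ-refl : (i : Fin n) → eqᵇ i i ≡ true
eqᵇ-refl zero    = refl
eqᵇ-refl (suc i) = eqᵇ-refl i

eqᵇ-≢ : {i j : Fin n} → i ≢ j → eqᵇ i j ≡ false
eqᵇ-≢ {i = i} {j} i≢j with eqᵇ i j in eq
... | false = refl
... | true  = contradiction (Fin.toℕ-injective (ℕ.≡ᵇ⇒≡ (toℕ i) (toℕ j) (subst T (sym eq) tt))) i≢j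

sum-cong : {F G : Fin n → ℤ} → F ≗ G → sumℤ n F ≡ sumℤ n G
sum-cong {zero}  e = refl
sum-cong {suc n} e = cong₂ _+_ (e zero) (sum-cong (e ∘ suc))

sum-cong-mod : {F G : Fin n → ℤ} → (∀ i → F i ≡ G i [mod N ]) → sumℤ n F ≡ sumℤ n G [mod N ]
sum-cong-mod {zero}  e = ≡mod-refl
sum-cong-mod {suc n} e = +-cong-mod (e zero) (sum-cong-mod (e ∘ suc))

sum-zero : ∀ n {F : Fin n → ℤ} → (∀ i → F i ≡ 0ℤ) → sumℤ n F ≡ 0ℤ
sum-zero zero    e = refl
sum-zero (suc n) e = cong₂ _+_ (e zero) (sum-zero n (e ∘ suc))

sum-zero-mod : ∀ n {F : Fin n → ℤ} → (∀ i → F i ≡ 0ℤ [mod N ]) → sumℤ n F ≡ 0ℤ [mod N ]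
sum-zero-mod n e = ≡mod-trans (sum-cong-mod {n} e) (≡⇒≡mod (sum-zero n (λ _ → refl)))

sum-+ : ∀ n (f f′ : Fin n → ℤ) → sumℤ n (λ i → f i + f′ i) ≡ sumℤ n f + sumℤ n f′
sum-+ zero    f f′ = refl
sum-+ (suc n) f f′ =
  trans (cong₂ _+_ {x = (f zero + f′ zero)} refl (sum-+ n (f ∘ suc) (f′ ∘ suc)))
        (lemma (f zero) (f′ zero) (sumℤ n (f ∘ suc)) (sumℤ n (f′ ∘ suc)))
  where
  lemma : ∀ a b c d → (a + b) + (c + d) ≡ (a + c) + (b + d)
  lemma = solve-∀

sum-*ˡ : ∀ n c (f : Fin n → ℤ) → sumℤ n (λ i → c * f i) ≡ c * sumℤ n f
sum-*ˡ zero    c f = sym (ℤ.*-zeroʳ c)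
sum-*ˡ (suc n) c f =
  trans (cong₂ _+_ {x = c * f zero} refl (sum-*ˡ n c (f ∘ suc)))
        (sym (ℤ.*-distribˡ-+ c (f zero) (sumℤ n (f ∘ suc))))

sum-*ʳ : ∀ n c (f : Fin n → ℤ) → sumℤ n (λ i → f i * c) ≡ sumℤ n f * c
sum-*ʳ n c f =
  trans (sum-cong (λ i → ℤ.*-comm (f i) c)) (trans (sum-*ˡ n c f) (ℤ.*-comm c (sumℤ n f)))

sum-swap : ∀ m n (F : Fin m → Fin n → ℤ) →
           sumℤ m (λ i → sumℤ n (F i)) ≡ sumℤ n (λ j → sumℤ m (λ i → F i j))
sum-swap zero    n F = sym (sum-zero n (λ _ → refl))
sum-swap (suc m) n F =
  trans (cong₂ _+_ {x = sumℤ n (F zero)} refl (sum-swap m n (F ∘ suc)))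
        (sym (sum-+ n (F zero) (λ j → sumℤ m (λ i → F (suc i) j))))

sum-single : ∀ n (f : Fin n → ℤ) a → (∀ i → i ≢ a → f i ≡ 0ℤ) → sumℤ n f ≡ f a
sum-single (suc n) f zero e =
  trans (cong₂ _+_ {x = f zero} refl (sum-zero n (λ i → e (suc i) λ ()))) (ℤ.+-identityʳ (f zero))
sum-single (suc n) f (suc a) e =
  trans (cong₂ _+_ (e zero λ ()) (sum-single n (f ∘ suc) a λ i i≢a → e (suc i) (i≢a ∘ Fin.suc-injective)))
        (ℤ.+-identityˡ (f (suc a)))

sum-if : ∀ n (f : Fin n → ℤ) a → sumℤ n (λ i → if eqᵇ i a then f i else 0ℤ) ≡ f a
sum-if n f a = trans (sum-single n _ a λ i i≢a → cong (if_then f i else 0ℤ) (eqᵇ-≢ i≢a))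
                     (cong (if_then f a else 0ℤ) (eqᵇ-refl a))

-- Row vector times matrix: definitionally, row i of X · Y is X i ∙ Y.
infixl 7 _∙_
_∙_ : (Fin m → ℤ) → Mat m n → Fin n → ℤ
_∙_ {m} c X j = sumℤ m (λ q → c q * X q j)

∙-assoc : (c : Fin l → ℤ) (X : Mat l m) (Y : Mat m n) → c ∙ X ∙ Y ≗ c ∙ (X · Y)
∙-assoc {l} {m} c X Y j = begin
  sumℤ m (λ q → sumℤ l (λ i → c i * X i q) * Y q j)
    ≡⟨ sum-cong (λ q → sum-*ʳ l (Y q j) (λ i → c i * X i q)) ⟨
  sumℤ m (λ q → sumℤ l (λ i → c i * X i q * Y q j))
    ≡⟨ sum-swap m l (λ q i → c i * X i q * Y q j) ⟩
  sumℤ l (λ i → sumℤ m (λ q → c i * X i q * Y q j))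
    ≡⟨ sum-cong (λ i → sum-cong (λ q → ℤ.*-assoc (c i) (X i q) (Y q j))) ⟩
  sumℤ l (λ i → sumℤ m (λ q → c i * (X i q * Y q j)))
    ≡⟨ sum-cong (λ i → sum-*ˡ m (c i) (λ q → X i q * Y q j)) ⟩
  sumℤ l (λ i → c i * sumℤ m (λ q → X i q * Y q j)) ∎
  where open ≡-Reasoning

∙-congˡ : (X : Mat m n) {c d : Fin m → ℤ} → c ≗ d → c ∙ X ≗ d ∙ X
∙-congˡ X e j = sum-cong (λ q → cong (_* X q j) (e q))

∙-congˡ-mod : (X : Mat m n) {c d : Fin m → ℤ} → (∀ i → c i ≡ d i [mod N ]) →
              ∀ j → (c ∙ X) j ≡ (d ∙ X) j [mod N ]
∙-congˡ-mod X e j = sum-cong-mod (λ q → *-congʳ-mod (X q j) (e q))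

∙-congʳ-mod : (c : Fin m → ℤ) {X Y : Mat m n} → (∀ i j → X i j ≡ Y i j [mod N ]) →
              ∀ j → (c ∙ X) j ≡ (c ∙ Y) j [mod N ]
∙-congʳ-mod c e j = sum-cong-mod (λ q → *-congˡ-mod (c q) (e q j))

∙-zeroˡ : (X : Mat m n) → (λ _ → 0ℤ) ∙ X ≗ λ _ → 0ℤ
∙-zeroˡ {m} X j = sum-zero m (λ q → ℤ.*-zeroˡ (X q j))

∙-zero-mod : (X : Mat m n) {c : Fin m → ℤ} → (∀ i → c i ≡ 0ℤ [mod N ]) →
             ∀ j → (c ∙ X) j ≡ 0ℤ [mod N ]
∙-zero-mod X e j = ≡mod-trans (∙-congˡ-mod X e j) (≡⇒≡mod (∙-zeroˡ X j))

∙-+ : (c d : Fin m → ℤ) (X : Mat m n) →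
      (λ i → c i + d i) ∙ X ≗ λ j → (c ∙ X) j + (d ∙ X) j
∙-+ {m} c d X j =
  trans (sum-cong (λ q → ℤ.*-distribʳ-+ (X q j) (c q) (d q)))
        (sum-+ m (λ q → c q * X q j) (λ q → d q * X q j))

∙-* : ∀ a (c : Fin m → ℤ) (X : Mat m n) → (λ i → a * c i) ∙ X ≗ λ j → a * (c ∙ X) j
∙-* {m} a c X j =
  trans (sum-cong (λ q → ℤ.*-assoc a (c q) (X q j))) (sum-*ˡ m a (λ q → c q * X q j))

unit : ℤ → Fin m → Fin m → ℤ
unit x i q = if eqᵇ q i then x else 0ℤ

∙-unit : ∀ x i (X : Mat m n) → unit x i ∙ X ≗ λ j → x * X i j
∙-unit {m} x i X j = trans (sum-single m _ i λ q q≢i → term q (eqᵇ-≢ q≢i))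
                           (cong (λ b → (if b then x else 0ℤ) * X i j) (eqᵇ-refl i))
  where
  term : ∀ q → eqᵇ q i ≡ false → unit x i q * X q j ≡ 0ℤ
  term q e rewrite e = ℤ.*-zeroˡ (X q j)

∙-idM : (c : Fin m → ℤ) → c ∙ idM m ≗ c
∙-idM {m} c j = trans (sum-cong term) (sum-if m c j)
  where
  term : ∀ q → c q * idM m q j ≡ (if eqᵇ q j then c q else 0ℤ)
  term q with eqᵇ q j
  ... | true  = ℤ.*-identityʳ (c q)
  ... | false = ℤ.*-zeroʳ (c q)

-- The criterion over ℤ/pᴷ

^-≡ : ∀ p {a b} → a ≤ b → p ^ b ≡ p ^ (b ∸ a) ℕ.* p ^ a
^-≡ p {a} {b} a≤b = trans (cong (p ^_) (sym (ℕ.m∸n+n≡m a≤b))) (ℕ.^-distribˡ-+-* p (b ∸ a) a)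

^-∣ : ∀ p {a b} → a ≤ b → p ^ a ∣ p ^ b
^-∣ p {a} {b} a≤b = ∣.divides (p ^ (b ∸ a)) (^-≡ p a≤b)

-- Divisibility by a power of `p` passes to smaller powers, so the first success of the descending
-- search determines all lower bounds. Lower bounds are all that the criterion asks for.
≤dpGo : ∀ p x k {r} → r ≤ dpGo p x k ⇔ (r ≤ k × p ^ r ∣ x)
≤dpGo p x zero = mk⇔ (λ { z≤n → z≤n , ∣.1∣ x }) proj₁
≤dpGo p x (suc k) with p ^ suc k ∣? x
... | yes d = mk⇔ (λ r≤k → r≤k , ∣.∣-trans (^-∣ p r≤k) d) proj₁
... | no ¬d = mk⇔ (λ r≤ → let r≤k , d = Equivalence.to (≤dpGo p x k) r≤ in ℕ.m≤n⇒m≤1+n r≤k , d)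
                  λ (r≤1+k , d) → Equivalence.from (≤dpGo p x k)
                    (ℕ.s≤s⁻¹ (ℕ.≤∧≢⇒< r≤1+k λ { refl → ¬d d }) , d)

≤dp : ∀ p K x {r} → r ≤ dp p K x ⇔ (r ≤ K × p ^ r ∣ abs x)
≤dp p (suc K) x = ≤dpGo p (abs x) (suc K)
-- For `K` = 0 both branches of `dp` are 0, the truncated `K ∸ 1` being 0 as well; for positive `K`
-- the test in `dp` is the first step of `dpGo` at `K`.
≤dp p zero x {r} = subst (λ d → r ≤ d ⇔ (r ≤ 0 × p ^ r ∣ abs x))
                         (sym (if-eta (does (1 ∣? abs x)))) (≤dpGo p (abs x) 0)

KernelInvariant : ℕ → Mat m n → Mat m m → Set
KernelInvariant {m} N X Y =
  ∀ (c : Fin m → ℤ) → (∀ j → (c ∙ X) j ≡ 0ℤ [mod N ]) → ∀ j → (c ∙ Y ∙ X) j ≡ 0ℤ [mod N ]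

∙-invPair : (X Y : Mat m m) → IsInvPair N m X Y → (c : Fin m → ℤ) →
            ∀ j → (c ∙ X ∙ Y) j ≡ c j [mod N ]
∙-invPair {m} {N} X Y XY c j = begin
  (c ∙ X ∙ Y) j      ≡⟨ ∙-assoc c X Y j ⟩
  (c ∙ (X · Y)) j    ≈⟨ ∙-congʳ-mod c {X · Y} {idM m} (λ i j → congruent (proj₁ (XY i j))) j ⟩
  (c ∙ idM m) j      ≡⟨ ∙-idM c j ⟩
  c j                ∎
  where open ≡mod-Reasoning N

module _ (Q Q⁻¹ : Mat m m) (T T⁻¹ : Mat n n) (QQ⁻¹ : IsInvPair N m Q Q⁻¹) (TT⁻¹ : IsInvPair N n T T⁻¹)
         (B : Mat m n) (S : Mat m m) where
  open ≡mod-Reasoning N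

  private
    Q⁻¹Q : IsInvPair N m Q⁻¹ Q
    Q⁻¹Q i j = swap (QQ⁻¹ i j)

    B⁰ : Mat m n
    B⁰ = (Q · B) · T

    P : Mat m m
    P = (Q · S) · Q⁻¹

    ∙B⁰ : ∀ d j → (d ∙ B⁰) j ≡ (d ∙ Q ∙ B ∙ T) j
    ∙B⁰ d j = sym (trans (∙-congˡ T (∙-assoc d Q B) j) (∙-assoc d (Q · B) T j))

    ∙P : ∀ d j → (d ∙ P) j ≡ (d ∙ Q ∙ S ∙ Q⁻¹) j
    ∙P d j = sym (trans (∙-congˡ Q⁻¹ (∙-assoc d Q S) j) (∙-assoc d (Q · S) Q⁻¹ j))

    ∙PB⁰ : ∀ d j → (d ∙ P ∙ B⁰) j ≡ (d ∙ Q ∙ S ∙ B ∙ T) j [mod N ]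
    ∙PB⁰ d j = begin
      (d ∙ P ∙ B⁰) j                   ≡⟨ ∙-congˡ B⁰ (∙P d) j ⟩
      (d ∙ Q ∙ S ∙ Q⁻¹ ∙ B⁰) j         ≡⟨ ∙B⁰ (d ∙ Q ∙ S ∙ Q⁻¹) j ⟩
      (d ∙ Q ∙ S ∙ Q⁻¹ ∙ Q ∙ B ∙ T) j
        ≈⟨ ∙-congˡ-mod T (∙-congˡ-mod B (∙-invPair Q⁻¹ Q Q⁻¹Q (d ∙ Q ∙ S))) j ⟩
      (d ∙ Q ∙ S ∙ B ∙ T) j            ∎

    cancel-T : (c : Fin n → ℤ) → (∀ j → (c ∙ T) j ≡ 0ℤ [mod N ]) → ∀ j → c j ≡ 0ℤ [mod N ]
    cancel-T c cT≡0 j = begin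
      c j              ≈⟨ ∙-invPair T T⁻¹ TT⁻¹ c j ⟨
      (c ∙ T ∙ T⁻¹) j  ≈⟨ ∙-zero-mod T⁻¹ cT≡0 j ⟩
      0ℤ               ∎

  -- The substitution c = d Q matches the two kernels modulo `N`, since `T` can be cancelled on the
  -- right. It carries `P` to `S` because Q⁻¹ Q collapses between `P` and `B⁰`.
  kernelInvariant-equiv : KernelInvariant N B S ⇔ KernelInvariant N B⁰ P
  kernelInvariant-equiv = mk⇔ to from
    where
    to : KernelInvariant N B S → KernelInvariant N B⁰ P
    to inv d dB⁰≡0 j = ≡mod-trans (∙PB⁰ d j) (∙-zero-mod T (inv (d ∙ Q) dQB≡0) j)
      where
      dQB≡0 = cancel-T (d ∙ Q ∙ B) λ j → ≡mod-trans (≡⇒≡mod (sym (∙B⁰ d j))) (dB⁰≡0 j)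

    from : KernelInvariant N B⁰ P → KernelInvariant N B S
    from inv c cB≡0 = cancel-T (c ∙ S ∙ B) λ j → begin
      (c ∙ S ∙ B ∙ T) j
        ≈⟨ ∙-congˡ-mod T (∙-congˡ-mod B (∙-congˡ-mod S (∙-invPair Q⁻¹ Q Q⁻¹Q c))) j ⟨
      (c ∙ Q⁻¹ ∙ Q ∙ S ∙ B ∙ T) j  ≈⟨ ∙PB⁰ (c ∙ Q⁻¹) j ⟨
      (c ∙ Q⁻¹ ∙ P ∙ B⁰) j         ≈⟨ inv (c ∙ Q⁻¹) dB⁰≡0 j ⟩
      0ℤ                           ∎
      where
      dB⁰≡0 : ∀ j → (c ∙ Q⁻¹ ∙ B⁰) j ≡ 0ℤ [mod N ]
      dB⁰≡0 j = begin
        (c ∙ Q⁻¹ ∙ B⁰) j         ≡⟨ ∙B⁰ (c ∙ Q⁻¹) j ⟩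
        (c ∙ Q⁻¹ ∙ Q ∙ B ∙ T) j  ≈⟨ ∙-congˡ-mod T (∙-congˡ-mod B (∙-invPair Q⁻¹ Q Q⁻¹Q c)) j ⟩
        (c ∙ B ∙ T) j            ≈⟨ ∙-zero-mod T cB≡0 j ⟩
        0ℤ                       ∎

module _ {p K : ℕ} .{{_ : ℕ.NonZero p}} (B⁰ : Mat m n) {s : Fin m → ℕ} (rank : ℕ) (rank≤n : rank ≤ n)
         (s<K : ∀ i → toℕ i < rank → s i < K) (s≡K : ∀ i → rank ≤ toℕ i → s i ≡ K)
         (s-mono : ∀ i j → toℕ i ≤ toℕ j → s i ≤ s j)
         (entries : ∀ i j → Cong (p ^ K) (B⁰ i j) (if eqᵇ i j then + (p ^ s i) else + 0)) where
  private
    s≤K : ∀ i → s i ≤ K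
    s≤K i with toℕ i ℕ.<? rank
    ... | yes i<l = ℕ.<⇒≤ (s<K i i<l)
    ... | no  i≮l = ℕ.≤-reflexive (s≡K i (ℕ.≮⇒≥ i≮l))

    D : Mat m n
    D i j = if eqᵇ i j then + (p ^ s i) else 0ℤ

    ∙D : ∀ (d : Fin m → ℤ) i j → toℕ j ≡ toℕ i → (d ∙ D) j ≡ d i * + (p ^ s i)
    ∙D d i j j≡i = trans (sum-cong term) (sum-if m (λ q → d q * + (p ^ s q)) i)
      where
      term : ∀ q → d q * D q j ≡ (if eqᵇ q i then d q * + (p ^ s q) else 0ℤ)
      term q rewrite j≡i with eqᵇ q i
      ... | true  = refl
      ... | false = ℤ.*-zeroʳ (d q)

    kernel-B⁰ : ∀ d → (∀ j → (d ∙ B⁰) j ≡ 0ℤ [mod p ^ K ]) ⇔ (∀ i → p ^ K ∣ abs (d i) ℕ.* p ^ s i)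
    kernel-B⁰ d = mk⇔ to from
      where
      abs-d*pˢ : ∀ i → abs (d i * + (p ^ s i)) ≡ abs (d i) ℕ.* p ^ s i
      abs-d*pˢ i = ℤ.abs-* (d i) (+ (p ^ s i))

      ∙B⁰≡∙D : ∀ j → (d ∙ B⁰) j ≡ (d ∙ D) j [mod p ^ K ]
      ∙B⁰≡∙D = ∙-congʳ-mod d (λ i j → congruent (entries i j))

      to : (∀ j → (d ∙ B⁰) j ≡ 0ℤ [mod p ^ K ]) → ∀ i → p ^ K ∣ abs (d i) ℕ.* p ^ s i
      to dB⁰≡0 i with toℕ i ℕ.<? n
      ... | yes i<n = subst (p ^ K ∣_) (abs-d*pˢ i) (≡0⇒∣abs
              (subst (_≡ 0ℤ [mod p ^ K ]) (∙D d i j (Fin.toℕ-fromℕ< i<n))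
                (≡mod-trans (≡mod-sym (∙B⁰≡∙D j)) (dB⁰≡0 j))))
        where j = fromℕ< i<n
      -- Such a row has no diagonal entry, but it lies beyond the rank, so its exponent is `K` and
      -- the divisibility holds for every `d i`.
      ... | no i≮n rewrite s≡K i (ℕ.≤-trans rank≤n (ℕ.≮⇒≥ i≮n)) = ∣.n∣m*n (abs (d i))

      from : (∀ i → p ^ K ∣ abs (d i) ℕ.* p ^ s i) → ∀ j → (d ∙ B⁰) j ≡ 0ℤ [mod p ^ K ]
      from K∣ j = ≡mod-trans (∙B⁰≡∙D j) (sum-zero-mod m term)
        where
        term : ∀ q → d q * D q j ≡ 0ℤ [mod p ^ K ]
        term q with eqᵇ q j
        ... | true  = ∣abs⇒≡0 (subst (p ^ K ∣_) (sym (abs-d*pˢ q)) (K∣ q))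
        ... | false = ≡⇒≡mod (ℤ.*-zeroʳ (d q))

  diagonal-criterion : ∀ P → KernelInvariant (p ^ K) B⁰ P ⇔
                         (∀ i j → toℕ j < toℕ i → s i ∸ s j ≤ dp p K (P i j))
  diagonal-criterion P = mk⇔ to from
    where
    to : KernelInvariant (p ^ K) B⁰ P → ∀ i j → toℕ j < toℕ i → s i ∸ s j ≤ dp p K (P i j)
    to inv i j j<i = Equivalence.from (≤dp p K (P i j))
      (ℕ.≤-trans (ℕ.m∸n≤m (s i) (s j)) (s≤K i) , ∣.*-cancelˡ-∣ (p ^ (K ∸ s i)) (∣.*-cancelʳ-∣ (p ^ s j) K∣))
      where
      instance
        _ = ℕ.m^n≢0 p (K ∸ s i)
        _ = ℕ.m^n≢0 p (s j)
      -- The multiple of the i-th unit vector that just lies in the kernel. The j-th entry of its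
      -- image is p^(K - sᵢ) Pᵢⱼ; splitting K as (K - sᵢ) + (sᵢ - sⱼ) + sⱼ lets the two outer powers
      -- be cancelled.
      d = unit (+ (p ^ (K ∸ s i))) i
      d-kernel : ∀ q → p ^ K ∣ abs (d q) ℕ.* p ^ s q
      d-kernel q with q Fin.≟ i
      ... | yes refl rewrite eqᵇ-refl q = ∣.∣-reflexive (^-≡ p (s≤K q))
      ... | no  q≢i  rewrite eqᵇ-≢ q≢i  = ∣._∣0 (p ^ K)
      K∣ : p ^ (K ∸ s i) ℕ.* p ^ (s i ∸ s j) ℕ.* p ^ s j ∣ p ^ (K ∸ s i) ℕ.* abs (P i j) ℕ.* p ^ s j
      K∣ = begin
        p ^ (K ∸ s i) ℕ.* p ^ (s i ∸ s j) ℕ.* p ^ s j   ≡⟨ ℕ.*-assoc (p ^ (K ∸ s i)) _ _ ⟩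
        p ^ (K ∸ s i) ℕ.* (p ^ (s i ∸ s j) ℕ.* p ^ s j)
          ≡⟨ cong (p ^ (K ∸ s i) ℕ.*_) (^-≡ p (s-mono j i (ℕ.<⇒≤ j<i))) ⟨
        p ^ (K ∸ s i) ℕ.* p ^ s i                       ≡⟨ ^-≡ p (s≤K i) ⟨
        p ^ K                                           ∣⟨ Equivalence.to (kernel-B⁰ (d ∙ P))
                                                             (inv d (Equivalence.from (kernel-B⁰ d) d-kernel)) j ⟩
        abs ((d ∙ P) j) ℕ.* p ^ s j                     ≡⟨ cong (λ z → abs z ℕ.* p ^ s j) (∙-unit _ i P j) ⟩
        abs (+ (p ^ (K ∸ s i)) * P i j) ℕ.* p ^ s j
          ≡⟨ cong (ℕ._* p ^ s j) (ℤ.abs-* (+ (p ^ (K ∸ s i))) (P i j)) ⟩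
        p ^ (K ∸ s i) ℕ.* abs (P i j) ℕ.* p ^ s j       ∎
        where open ∣.∣-Reasoning

    from : (∀ i j → toℕ j < toℕ i → s i ∸ s j ≤ dp p K (P i j)) → KernelInvariant (p ^ K) B⁰ P
    from le d dB⁰≡0 = Equivalence.from (kernel-B⁰ (d ∙ P)) λ j →
      subst (p ^ K ∣_) (trans (cong abs (sum-*ʳ m (+ (p ^ s j)) (λ i → d i * P i j)))
                              (ℤ.abs-* ((d ∙ P) j) (+ (p ^ s j))))
        (≡0⇒∣abs (sum-zero-mod m λ i → ∣abs⇒≡0 (K∣ i j)))
      where
      divides-P : ∀ i j → p ^ (s i ∸ s j) ∣ abs (P i j)
      divides-P i j with toℕ j ℕ.<? toℕ i
      ... | yes j<i = proj₂ (Equivalence.to (≤dp p K (P i j)) (le i j j<i))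
      -- On and above the diagonal monotonicity makes the truncated difference zero, so the
      -- conditions below the diagonal suffice.
      ... | no  j≮i rewrite ℕ.m≤n⇒m∸n≡0 (s-mono i j (ℕ.≮⇒≥ j≮i)) = ∣.1∣ _
      K∣ : ∀ i j → p ^ K ∣ abs (d i * P i j * + (p ^ s j))
      K∣ i j = begin
        p ^ K                                         ∣⟨ Equivalence.to (kernel-B⁰ d) dB⁰≡0 i ⟩
        abs (d i) ℕ.* p ^ s i
          -- Truncation does no harm: sᵢ ≤ (sᵢ ∸ sⱼ) + sⱼ for every pair.
          ∣⟨ ∣.*-monoʳ-∣ (abs (d i)) (^-∣ p (ℕ.≤-trans (ℕ.m≤n+m∸n (s i) (s j))
                                      (ℕ.≤-reflexive (ℕ.+-comm (s j) _)))) ⟩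
        abs (d i) ℕ.* p ^ (s i ∸ s j ℕ.+ s j)
          ≡⟨ cong (abs (d i) ℕ.*_) (ℕ.^-distribˡ-+-* p (s i ∸ s j) (s j)) ⟩
        abs (d i) ℕ.* (p ^ (s i ∸ s j) ℕ.* p ^ s j)
          ∣⟨ ∣.*-monoʳ-∣ (abs (d i)) (∣.*-monoˡ-∣ (p ^ s j) (divides-P i j)) ⟩
        abs (d i) ℕ.* (abs (P i j) ℕ.* p ^ s j)       ≡⟨ ℕ.*-assoc (abs (d i)) _ _ ⟨
        abs (d i) ℕ.* abs (P i j) ℕ.* p ^ s j         ≡⟨ cong (ℕ._* p ^ s j) (ℤ.abs-* (d i) (P i j)) ⟨
        abs (d i * P i j) ℕ.* p ^ s j                 ≡⟨ ℤ.abs-* (d i * P i j) (+ (p ^ s j)) ⟨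
        abs (d i * P i j * + (p ^ s j))               ∎
        where open ∣.∣-Reasoning

normalForm-criterion : ∀ {p K} .{{_ : ℕ.NonZero p}} (B⁰ : Mat m n) {s} → IsNormalForm p K m n B⁰ s →
  ∀ P → KernelInvariant (p ^ K) B⁰ P ⇔ (∀ i j → toℕ j < toℕ i → s i ∸ s j ≤ dp p K (P i j))
normalForm-criterion B⁰ (_ , rank , _ , rank≤n , s<K , s≡K , s-mono , entries) =
  diagonal-criterion B⁰ rank rank≤n s<K s≡K s-mono entries

-- Localisation at the primes

prime∤1 : ∀ {p} → Prime p → ¬ p ∣ 1
prime∤1 pp p∣1 = ¬prime[1] (subst Prime (∣.∣1⇒≡1 p∣1) pp)

prime∤^ : ∀ {p q} → Prime p → Prime q → p ≢ q → ∀ k → ¬ p ∣ q ^ k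
prime∤^ pp pq p≢q zero    p∣1 = prime∤1 pp p∣1
prime∤^ {p} {q} pp pq p≢q (suc k) p∣q^1+k with euclidsLemma q (q ^ k) pp p∣q^1+k
... | inj₂ p∣q^k = prime∤^ pp pq p≢q k p∣q^k
... | inj₁ p∣q with prime⇒irreducible pq p∣q
...   | inj₁ refl = ¬prime[1] pp
...   | inj₂ p≡q  = p≢q p≡q

prime∤product : ∀ {p} → Prime p → ∀ {ns} → All (λ n → ¬ p ∣ n) ns → ¬ p ∣ product ns
prime∤product pp []           p∣1    = prime∤1 pp p∣1
prime∤product pp {n ∷ ns} (p∤n ∷ p∤ns) p∣n*ns =
  [ p∤n , prime∤product pp p∤ns ]′ (euclidsLemma n (product ns) pp p∣n*ns)

-- Euclid's lemma moves one factor `p` at a time into `x`, where it can be divided out of both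
-- sides.
prime^-cancel : ∀ {p} → Prime p → ∀ {m} → ¬ p ∣ m → ∀ k x → p ^ k ∣ m ℕ.* x → p ^ k ∣ x
prime^-cancel pp p∤m zero x d = ∣.1∣ x
prime^-cancel {p} pp {m} p∤m (suc k) x d
  with euclidsLemma m x pp (∣.∣-trans (∣.m∣m*n (p ^ k)) d)
... | inj₁ p∣m = contradiction p∣m p∤m
... | inj₂ (∣.divides y refl) =
  subst (p ℕ.* p ^ k ∣_) (ℕ.*-comm p y) (∣.*-monoʳ-∣ p (prime^-cancel pp p∤m k y
    (∣.*-cancelˡ-∣ p (subst (p ℕ.* p ^ k ∣_) (lemma m y p) d))))
  where
  instance _ = prime⇒nonZero pp
  lemma : ∀ m y p → m ℕ.* (y ℕ.* p) ≡ p ℕ.* (m ℕ.* y)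
  lemma m y p = trans (sym (ℕ.*-assoc m y p)) (ℕ.*-comm (m ℕ.* y) p)

module _ {σ : Shape} (primary : IsPrimaryShape σ) where
  open IsPrimaryShape primary

  k≤K : ∀ γ η → k σ γ η ≤ Kγ σ γ
  k≤K γ η = mono γ η (fromℕ (a σ γ))
              (ℕ.≤-trans (ℕ.s≤s⁻¹ (Fin.toℕ<n η)) (ℕ.≤-reflexive (sym (Fin.toℕ-fromℕ (a σ γ)))))

module _ {σ : Shape} (primary : IsPrimaryShape σ) (θ : (γ : Fin (g σ)) → Mat t (suc (a σ γ))) where
  open IsPrimaryShape primary

  -- The kernel of the homomorphism from ℤᵗ to A that sends the i-th unit vector to the voltage θᵢ.
  InKernel : (Fin t → ℤ) → Set
  InKernel c = ∀ γ η → (c ∙ θ γ) η ≡ 0ℤ [mod p σ γ ^ k σ γ η ]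

  private
    B : (γ : Fin (g σ)) → Mat t (suc (a σ γ))
    B γ i j = + (p σ γ ^ (Kγ σ γ ∸ k σ γ j)) * θ γ i j

    abs-∙B : ∀ c γ η → abs ((c ∙ B γ) η) ≡ p σ γ ^ (Kγ σ γ ∸ k σ γ η) ℕ.* abs ((c ∙ θ γ) η)
    abs-∙B c γ η = trans (cong abs (trans (sum-cong λ q → lemma (c q) w (θ γ q η))
                                         (sum-*ˡ _ w (λ q → c q * θ γ q η))))
                         (ℤ.abs-* w ((c ∙ θ γ) η))
      where
      w = + (p σ γ ^ (Kγ σ γ ∸ k σ γ η))
      lemma : ∀ x y z → x * (y * z) ≡ y * (x * z)
      lemma = solve-∀

    -- The weight p^(K - k) in column η of `B` exists for this: it embeds ℤ/p^k into ℤ/p^K, so that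
    -- all columns share one modulus.
    kernel-B : ∀ c γ η → (c ∙ B γ) η ≡ 0ℤ [mod p σ γ ^ Kγ σ γ ] ⇔
                         (c ∙ θ γ) η ≡ 0ℤ [mod p σ γ ^ k σ γ η ]
    kernel-B c γ η = mk⇔
      (λ e → ∣abs⇒≡0 (∣.*-cancelˡ-∣ w (subst (w ℕ.* p σ γ ^ k σ γ η ∣_) (abs-∙B c γ η)
                       (subst (_∣ abs ((c ∙ B γ) η)) (^-≡ (p σ γ) (k≤K primary γ η)) (≡0⇒∣abs e)))))
      (λ e → ∣abs⇒≡0 (subst (p σ γ ^ Kγ σ γ ∣_) (sym (abs-∙B c γ η))
                       (subst (_∣ w ℕ.* abs ((c ∙ θ γ) η)) (sym (^-≡ (p σ γ) (k≤K primary γ η)))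
                         (∣.*-monoʳ-∣ w (≡0⇒∣abs e)))))
      where
      w = p σ γ ^ (Kγ σ γ ∸ k σ γ η)
      instance
        _ = prime⇒nonZero (prime γ)
        _ = ℕ.m^n≢0 (p σ γ) (Kγ σ γ ∸ k σ γ η)

    -- The product of these over δ is divisible by the full modulus of every other prime, yet
    -- coprime to `p σ γ`: multiplication by it isolates the component γ.
    cofactor : Fin (g σ) → Fin (g σ) → ℕ
    cofactor γ δ with δ Fin.≟ γ
    ... | yes _ = 1
    ... | no  _ = p σ δ ^ Kγ σ δ

    M : Fin (g σ) → ℕ
    M γ = product (tabulate (cofactor γ))

    p∤cofactor : ∀ γ δ → ¬ p σ γ ∣ cofactor γ δ
    p∤cofactor γ δ with δ Fin.≟ γ
    ... | yes _  = prime∤1 (prime γ)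
    ... | no δ≢γ = prime∤^ (prime γ) (prime δ) (δ≢γ ∘ sym ∘ distinct γ δ) (Kγ σ δ)

    p∤M : ∀ γ → ¬ p σ γ ∣ M γ
    p∤M γ = prime∤product (prime γ) (All.tabulate⁺ (p∤cofactor γ))

    ∣M : ∀ {γ δ} → δ ≢ γ → p σ δ ^ Kγ σ δ ∣ M γ
    ∣M {γ} {δ} δ≢γ = subst (_∣ M γ) cofactor≡ (∈⇒∣product (∈-tabulate⁺ δ))
      where
      cofactor≡ : cofactor γ δ ≡ p σ δ ^ Kγ σ δ
      cofactor≡ with δ Fin.≟ γ
      ... | yes δ≡γ = contradiction δ≡γ δ≢γ
      ... | no  _   = refl

  kernel-localisation : (S : Mat t t) →
    (∀ c → InKernel c → InKernel (c ∙ S)) ⇔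
    (∀ γ → KernelInvariant (p σ γ ^ Kγ σ γ) (B γ) S)
  kernel-localisation S = mk⇔ to from
    where
    from : (∀ γ → KernelInvariant (p σ γ ^ Kγ σ γ) (B γ) S) → ∀ c → InKernel c → InKernel (c ∙ S)
    from inv c c∈ker γ η = Equivalence.to (kernel-B (c ∙ S) γ η)
      (inv γ c (λ j → Equivalence.from (kernel-B c γ j) (c∈ker γ j)) η)

    to : (∀ c → InKernel c → InKernel (c ∙ S)) → ∀ γ → KernelInvariant (p σ γ ^ Kγ σ γ) (B γ) S
    to inv γ c cB≡0 η = ∣abs⇒≡0 (prime^-cancel (prime γ) (p∤M γ) (Kγ σ γ) _
      (subst (p σ γ ^ Kγ σ γ ∣_) (trans (cong abs M-out) (ℤ.abs-* (+ M γ) _))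
        (≡0⇒∣abs (Equivalence.from (kernel-B (Mc ∙ S) γ η) (inv Mc Mc∈ker γ η)))))
      where
      -- A vector known to be in the kernel only at γ enters the whole kernel after scaling by
      -- `M γ`; the factor is cancelled again at γ, where it is coprime to the modulus.
      Mc : Fin t → ℤ
      Mc i = + M γ * c i

      Mc∈ker : InKernel Mc
      Mc∈ker δ j = Equivalence.to (kernel-B Mc δ j) (≡mod-trans (≡⇒≡mod (∙-* (+ M γ) c (B δ) j)) (lemma δ j))
        where
        lemma : ∀ δ j → + M γ * (c ∙ B δ) j ≡ 0ℤ [mod p σ δ ^ Kγ σ δ ]
        lemma δ j with δ Fin.≟ γ
        ... | yes refl = ≡mod-trans (*-congˡ-mod (+ M γ) (cB≡0 j)) (≡⇒≡mod (ℤ.*-zeroʳ (+ M γ)))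
        ... | no δ≢γ   = ∣abs⇒≡0 (subst (p σ δ ^ Kγ σ δ ∣_) (sym (ℤ.abs-* (+ M γ) ((c ∙ B δ) j)))
                           (∣.∣m⇒∣m*n _ (∣M δ≢γ)))

      M-out : (Mc ∙ S ∙ B γ) η ≡ + M γ * (c ∙ S ∙ B γ) η
      M-out = trans (∙-congˡ (B γ) (∙-* (+ M γ) c S) η) (∙-* (+ M γ) (c ∙ S) (B γ) η)

-- Walks and homology

ArcFun : ℕ → Set
ArcFun n = Fin n → Fin n → ℤ

arcSum : ArcFun n → List (Fin n × Fin n) → ℤ
arcSum ψ []             = 0ℤ
arcSum ψ ((u , v) ∷ es) = ψ u v + arcSum ψ es

pathSum : ArcFun n → Fin n → List (Fin n) → ℤ
pathSum ψ x xs = arcSum ψ (arcsFrom x xs)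

InGraph : (Fin n → Fin n → Bool) → List (Fin n × Fin n) → Set
InGraph E = All (λ e → E (proj₁ e) (proj₂ e) ≡ true)

-- Restricted to the arcs of `E` and to one modulus, because voltages of non-adjacent pairs are
-- arbitrary.
Antisymmetric : ℕ → (Fin n → Fin n → Bool) → ArcFun n → Set
Antisymmetric N E ψ = ∀ u v → E u v ≡ true → ψ v u ≡ - ψ u v [mod N ]

arcsFrom-++ : (x : Fin n) (xs ys : List (Fin n)) →
              arcsFrom x (xs ++ ys) ≡ arcsFrom x xs ++ arcsFrom (lastV x xs) ys
arcsFrom-++ x []       ys = refl
arcsFrom-++ x (y ∷ xs) ys = cong ((x , y) ∷_) (arcsFrom-++ y xs ys)

lastV-++ : (x : Fin n) (xs ys : List (Fin n)) → lastV x (xs ++ ys) ≡ lastV (lastV x xs) ys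
lastV-++ x []       ys = refl
lastV-++ x (y ∷ xs) ys = lastV-++ y xs ys

lastV-map : (h : Fin n → Fin n) (x : Fin n) (xs : List (Fin n)) → lastV (h x) (map h xs) ≡ h (lastV x xs)
lastV-map h x []       = refl
lastV-map h x (y ∷ xs) = lastV-map h y xs

arcSum-++ : (ψ : ArcFun n) → ∀ es es′ → arcSum ψ (es ++ es′) ≡ arcSum ψ es + arcSum ψ es′
arcSum-++ ψ []             es′ = sym (ℤ.+-identityˡ _)
arcSum-++ ψ ((u , v) ∷ es) es′ =
  trans (cong₂ _+_ {x = ψ u v} refl (arcSum-++ ψ es es′))
        (sym (ℤ.+-assoc (ψ u v) (arcSum ψ es) (arcSum ψ es′)))

pathSum-++ : (ψ : ArcFun n) (x : Fin n) (xs ys : List (Fin n)) →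
             pathSum ψ x (xs ++ ys) ≡ pathSum ψ x xs + pathSum ψ (lastV x xs) ys
pathSum-++ ψ x xs ys =
  trans (cong (arcSum ψ) (arcsFrom-++ x xs ys)) (arcSum-++ ψ (arcsFrom x xs) (arcsFrom (lastV x xs) ys))

pathSum-map : (ψ : ArcFun n) (h : Fin n → Fin n) (x : Fin n) (xs : List (Fin n)) →
              pathSum ψ (h x) (map h xs) ≡ pathSum (λ u v → ψ (h u) (h v)) x xs
pathSum-map ψ h x []       = refl
pathSum-map ψ h x (y ∷ xs) = cong₂ _+_ {x = ψ (h x) (h y)} refl (pathSum-map ψ h y xs)

inGraph-map : {E E′ : Fin n → Fin n → Bool} (h : Fin n → Fin n) →
              (∀ u v → E u v ≡ true → E′ (h u) (h v) ≡ true) →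
              ∀ x xs → InGraph E (arcsFrom x xs) → InGraph E′ (arcsFrom (h x) (map h xs))
inGraph-map h imp x []       []       = []
inGraph-map h imp x (y ∷ xs) (e ∷ es) = imp x y e ∷ inGraph-map h imp y xs es

arcSum-cong : {E : Fin n → Fin n → Bool} {ψ ψ′ : ArcFun n} →
              (∀ u v → E u v ≡ true → ψ u v ≡ ψ′ u v [mod N ]) →
              ∀ {es} → InGraph E es → arcSum ψ es ≡ arcSum ψ′ es [mod N ]
arcSum-cong ψ≡ψ′ []       = ≡mod-refl
arcSum-cong ψ≡ψ′ (e ∷ es) = +-cong-mod (ψ≡ψ′ _ _ e) (arcSum-cong ψ≡ψ′ es)

arcSum-zero : {E : Fin n → Fin n → Bool} {ψ : ArcFun n} →
              (∀ u v → E u v ≡ true → ψ u v ≡ 0ℤ [mod N ]) →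
              ∀ {es} → InGraph E es → arcSum ψ es ≡ 0ℤ [mod N ]
arcSum-zero ψ≡0 []       = ≡mod-refl
arcSum-zero ψ≡0 (e ∷ es) = +-cong-mod (ψ≡0 _ _ e) (arcSum-zero ψ≡0 es)

-- Nonempty `as` makes the loop `bs` shorter than the walk, and nonempty `bs` does the same for the
-- rest `as ++ cs`. The start `x` is left out of the search because a closed walk meets it again at
-- its end.
uniqueOrLoop : (x : Fin n) (xs : List (Fin n)) →
  Unique xs ⊎ ∃ λ as → ∃ λ bs → ∃ λ cs →
    xs ≡ as ++ bs ++ cs × 1 ≤ length as × 1 ≤ length bs × lastV (lastV x as) bs ≡ lastV x as
uniqueOrLoop x [] = inj₁ []
uniqueOrLoop x (y ∷ xs) with _∈?_ Fin._≟_ y xs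
... | yes y∈xs with bs , cs , refl ← ∈-∃++ y∈xs =
  inj₂ ([ y ] , bs ++ [ y ] , cs , cong (y ∷_) (sym (List.++-assoc bs [ y ] cs)) , s≤s z≤n ,
        ℕ.≤-trans (ℕ.m≤n+m 1 (length bs)) (ℕ.≤-reflexive (sym (List.length-++ bs))) , lastV-++ y bs [ y ])
... | no y∉xs with uniqueOrLoop y xs
...   | inj₁ u = inj₁ (All.¬Any⇒All¬ xs y∉xs ∷ u)
...   | inj₂ (as , bs , cs , refl , _ , 1≤b , loop) = inj₂ (y ∷ as , bs , cs , refl , s≤s z≤n , 1≤b , loop)

module _ {Γ : Graph n} {Tr : Fin n → Fin n → Bool} (tree : IsSpanningTree Γ Tr)
         {ψ : ArcFun n} (anti : Antisymmetric N Tr ψ) where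
  open IsSpanningTree tree

  -- By acyclicity a closed tree walk goes back and forth along one edge or repeats a vertex;
  -- in the latter case it is cut into two shorter ones.
  private
    closed-sum : ∀ b x xs → length xs ≤ b → InGraph Tr (arcsFrom x xs) → lastV x xs ≡ x →
                 pathSum ψ x xs ≡ 0ℤ [mod N ]
    closed-sum b x [] _ _ _ = ≡mod-refl
    closed-sum (suc b) x xs@(y ∷ ys) len inTr closed with uniqueOrLoop x xs
    closed-sum (suc b) x (.x ∷ []) _ (e ∷ _) refl | inj₁ _ =
      contradiction (trans (sym (sub x x e)) (Adj-irrefl Γ x)) λ ()
    closed-sum (suc b) x (y ∷ .x ∷ []) _ (e ∷ _) refl | inj₁ _ = begin
      ψ x y + (ψ y x + 0ℤ)  ≡⟨ cong₂ _+_ {x = ψ x y} refl (ℤ.+-identityʳ (ψ y x)) ⟩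
      ψ x y + ψ y x         ≈⟨ +-cong-mod (≡mod-refl {ψ x y}) (anti x y e) ⟩
      ψ x y - ψ x y         ≡⟨ ℤ.+-inverseʳ (ψ x y) ⟩
      0ℤ                    ∎
      where open ≡mod-Reasoning N
    closed-sum (suc b) x xs@(_ ∷ _ ∷ _ ∷ _) _ inTr closed | inj₁ unique =
      contradiction (inTr , closed , s≤s (s≤s (s≤s z≤n)) , unique) (acyclic (walk x xs))
    closed-sum (suc b) x xs@(_ ∷ _) len inTr closed | inj₂ (as , bs , cs , eq , 1≤as , 1≤bs , loop) = begin
      pathSum ψ x xs                                      ≡⟨ cong (pathSum ψ x) eq ⟩
      pathSum ψ x (as ++ bs ++ cs)                        ≡⟨ pathSum-++ ψ x as (bs ++ cs) ⟩
      A + pathSum ψ z (bs ++ cs)                          ≡⟨ cong₂ _+_ {x = A} refl (pathSum-++ ψ z bs cs) ⟩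
      A + (pathSum ψ z bs + pathSum ψ (lastV z bs) cs)
        ≡⟨ cong (λ v → A + (pathSum ψ z bs + pathSum ψ v cs)) loop ⟩
      A + (pathSum ψ z bs + C)
        ≈⟨ +-cong-mod (≡mod-refl {A}) (+-cong-mod inner ≡mod-refl) ⟩
      A + (0ℤ + C)                                        ≡⟨ cong₂ _+_ {x = A} refl (ℤ.+-identityˡ C) ⟩
      A + C                                               ≡⟨ pathSum-++ ψ x as cs ⟨
      pathSum ψ x (as ++ cs)                              ≈⟨ outer ⟩
      0ℤ                                                  ∎
      where
      open ≡mod-Reasoning N
      z = lastV x as
      A = pathSum ψ x as
      C = pathSum ψ z cs

      len-split : length as ℕ.+ (length bs ℕ.+ length cs) ≤ suc b
      len-split = subst (_≤ suc b)
        (trans (cong length eq) (trans (List.length-++ as) (cong (length as ℕ.+_) (List.length-++ bs)))) len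

      all-split : InGraph Tr (arcsFrom x as ++ (arcsFrom z bs ++ arcsFrom z cs))
      all-split = subst (InGraph Tr)
        (trans (cong (arcsFrom x) eq) (trans (arcsFrom-++ x as (bs ++ cs))
          (cong (arcsFrom x as ++_) (trans (arcsFrom-++ z bs cs)
            (cong (λ v → arcsFrom z bs ++ arcsFrom v cs) loop)))))
        inTr

      inner : pathSum ψ z bs ≡ 0ℤ [mod N ]
      inner = closed-sum b z bs
        (ℕ.s≤s⁻¹ (ℕ.≤-trans (ℕ.+-mono-≤ 1≤as (ℕ.m≤m+n (length bs) (length cs))) len-split))
        (All.++⁻ˡ (arcsFrom z bs) (All.++⁻ʳ (arcsFrom x as) all-split)) loop

      outer : pathSum ψ x (as ++ cs) ≡ 0ℤ [mod N ]
      outer = closed-sum b x (as ++ cs)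
        (ℕ.s≤s⁻¹ (ℕ.≤-trans (ℕ.≤-reflexive (trans (cong suc (List.length-++ as))
                                                   (sym (ℕ.+-suc (length as) (length cs)))))
                   (ℕ.≤-trans (ℕ.+-monoʳ-≤ (length as) (ℕ.+-monoˡ-≤ (length cs) 1≤bs)) len-split)))
        (subst (InGraph Tr) (sym (arcsFrom-++ x as cs))
          (All.++⁺ (All.++⁻ˡ (arcsFrom x as) all-split)
                   (All.++⁻ʳ (arcsFrom z bs) (All.++⁻ʳ (arcsFrom x as) all-split))))
        last-outer
        where
        last-outer : lastV x (as ++ cs) ≡ x
        last-outer = trans (lastV-++ x as cs) (trans (cong (λ v → lastV v cs) (sym loop))
          (trans (sym (lastV-++ z bs cs)) (trans (sym (lastV-++ x as (bs ++ cs)))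
            (trans (cong (lastV x) (sym eq)) closed))))

  closedTreeSum : ∀ x xs → InGraph Tr (arcsFrom x xs) → lastV x xs ≡ x → pathSum ψ x xs ≡ 0ℤ [mod N ]
  closedTreeSum x xs = closed-sum (length xs) x xs ℕ.≤-refl

-- Walk sums as linear functionals of chains

sum-indicator : ∀ n (a b : Fin n) (M : Mat n n) →
  sumℤ n (λ u → sumℤ n (λ v → (if eqᵇ a u ∧ eqᵇ b v then + 1 else + 0) * M u v)) ≡ M a b
sum-indicator n a b M = trans (sum-single n _ a λ u u≢a → sum-zero n (off-row u (u≢a ∘ sym)))
  (trans (sum-single n _ b λ v v≢b → off-column v (v≢b ∘ sym)) diagonal)
  where
  off-row : ∀ u → a ≢ u → ∀ v → (if eqᵇ a u ∧ eqᵇ b v then + 1 else + 0) * M u v ≡ 0ℤ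
  off-row u a≢u v rewrite eqᵇ-≢ a≢u = ℤ.*-zeroˡ (M u v)
  off-column : ∀ v → b ≢ v → (if eqᵇ a a ∧ eqᵇ b v then + 1 else + 0) * M a v ≡ 0ℤ
  off-column v b≢v rewrite eqᵇ-≢ b≢v | ∧-zeroʳ (eqᵇ a a) = ℤ.*-zeroˡ (M a v)
  diagonal : (if eqᵇ a a ∧ eqᵇ b b then + 1 else + 0) * M a b ≡ M a b
  diagonal rewrite eqᵇ-refl a | eqᵇ-refl b = ℤ.*-identityˡ (M a b)

arcChain : Fin n → Fin n → ArcFun n
arcChain u v a b = (if eqᵇ a u ∧ eqᵇ b v then + 1 else + 0) - (if eqᵇ a v ∧ eqᵇ b u then + 1 else + 0)

chainW-arcSum : (w : Walk n) (u v : Fin n) → chainW w u v ≡ arcSum (arcChain u v) (arcsW w)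
chainW-arcSum w u v = lemma _ (arcsW w)
  where
  lemma : ∀ {n} (χ : Fin n × Fin n → ℤ) es →
          foldr (λ e acc → acc + χ e) 0ℤ es ≡ arcSum (λ a b → χ (a , b)) es
  lemma χ []       = refl
  lemma χ (e ∷ es) = trans (cong (_+ χ e) (lemma χ es)) (ℤ.+-comm _ (χ e))

-- Homology relations are equalities between chains, while walk sums are defined on lists of arcs.
-- This bilinear form expresses the latter through the former.
pairing : Mat n n → Mat n n → ℤ
pairing {n} C M = sumℤ n (λ u → sumℤ n (λ v → C u v * M u v))

pairing-+ˡ : (C C′ M : Mat n n) → pairing (λ u v → C u v + C′ u v) M ≡ pairing C M + pairing C′ M
pairing-+ˡ {n} C C′ M =
  trans (sum-cong λ u → trans (sum-cong λ v → ℤ.*-distribʳ-+ (M u v) (C u v) (C′ u v)) (sum-+ n _ _))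
        (sum-+ n _ _)

pairing-combination : (c : Fin t → ℤ) (C : Fin t → Mat n n) (M : Mat n n) →
  pairing (λ u v → sumℤ t (λ j → c j * C j u v)) M ≡ sumℤ t (λ j → c j * pairing (C j) M)
pairing-combination {t} {n} c C M = begin
  sumℤ n (λ u → sumℤ n (λ v → sumℤ t (λ j → c j * C j u v) * M u v))
    -- For fixed `u` this is associativity of row vector, matrix and the column `M u`, the last
    -- written as a one-column matrix.
    ≡⟨ sum-cong (λ u → ∙-assoc c (λ j v → C j u v) (λ v (_ : Fin 1) → M u v) zero) ⟩
  sumℤ n (λ u → sumℤ t (λ j → c j * sumℤ n (λ v → C j u v * M u v)))
    ≡⟨ sum-swap n t _ ⟩
  sumℤ t (λ j → sumℤ n (λ u → c j * sumℤ n (λ v → C j u v * M u v)))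
    ≡⟨ sum-cong (λ j → sum-*ˡ n (c j) _) ⟩
  sumℤ t (λ j → c j * pairing (C j) M) ∎
  where open ≡-Reasoning

-- Both orientations of the edge contribute. For an antisymmetric `M` the value is 2 M(a,b), and 2
-- cannot be cancelled when a modulus is even; hence the one-sided matrix `upper` below.
pairing-arcChain : (a b : Fin n) (M : Mat n n) → pairing (λ u v → arcChain u v a b) M ≡ M a b - M b a
pairing-arcChain {n} a b M = begin
  pairing (λ u v → arcChain u v a b) M  ≡⟨ sum-cong (λ u → sum-cong (λ v → term u v)) ⟩
  pairing (λ u v → I a b u v + - 1ℤ * I b a u v) M
    ≡⟨ pairing-+ˡ (I a b) (λ u v → - 1ℤ * I b a u v) M ⟩
  pairing (I a b) M + pairing (λ u v → - 1ℤ * I b a u v) M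
    ≡⟨ cong₂ _+_ (sum-indicator n a b M) negated ⟩
  M a b + - 1ℤ * M b a  ≡⟨ cong₂ _+_ {x = M a b} refl (ℤ.-1*i≡-i (M b a)) ⟩
  M a b - M b a         ∎
  where
  open ≡-Reasoning
  I : Fin n → Fin n → Mat n n
  I a b u v = if eqᵇ a u ∧ eqᵇ b v then + 1 else + 0
  negated : pairing (λ u v → - 1ℤ * I b a u v) M ≡ - 1ℤ * M b a
  negated = begin
    pairing (λ u v → - 1ℤ * I b a u v) M
      ≡⟨ sum-cong (λ u → sum-cong (λ v → ℤ.*-assoc (- 1ℤ) (I b a u v) (M u v))) ⟩
    sumℤ n (λ u → sumℤ n (λ v → - 1ℤ * (I b a u v * M u v)))
      ≡⟨ sum-cong (λ u → sum-*ˡ n (- 1ℤ) (λ v → I b a u v * M u v)) ⟩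
    sumℤ n (λ u → - 1ℤ * sumℤ n (λ v → I b a u v * M u v))
      ≡⟨ sum-*ˡ n (- 1ℤ) _ ⟩
    - 1ℤ * pairing (I b a) M
      ≡⟨ cong (- 1ℤ *_) (sum-indicator n b a M) ⟩
    - 1ℤ * M b a ∎
  term : ∀ u v → arcChain u v a b * M u v ≡ (I a b u v + - 1ℤ * I b a u v) * M u v
  term u v rewrite ∧-comm (eqᵇ a v) (eqᵇ b u) | ℤ.-1*i≡-i (I b a u v) = refl

-- Each undirected edge is counted once in the pairing with a chain, through its orientation u < v.
upper : ArcFun n → Mat n n
upper ψ u v with toℕ u ℕ.<? toℕ v
... | yes _ = ψ u v
... | no  _ = 0ℤ

module _ (Γ : Graph n) {ψ : ArcFun n} (anti : Antisymmetric N (Adj Γ) ψ) where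
  upper-antisymmetrised : ∀ u v → Adj Γ u v ≡ true → upper ψ u v - upper ψ v u ≡ ψ u v [mod N ]
  upper-antisymmetrised u v e with toℕ u ℕ.<? toℕ v | toℕ v ℕ.<? toℕ u
  ... | yes u<v | yes v<u = contradiction v<u (ℕ.<-asym u<v)
  ... | yes u<v | no  _   = ≡⇒≡mod (ℤ.+-identityʳ (ψ u v))
  ... | no  _   | yes v<u = begin
    0ℤ - ψ v u      ≡⟨ ℤ.+-identityˡ (- ψ v u) ⟩
    - ψ v u         ≈⟨ neg-cong-mod (anti u v e) ⟩
    - - ψ u v       ≡⟨ ℤ.neg-involutive (ψ u v) ⟩
    ψ u v           ∎
    where open ≡mod-Reasoning N
  ... | no  u≮v | no  v≮u with Fin.toℕ-injective (ℕ.≤-antisym (ℕ.≮⇒≥ v≮u) (ℕ.≮⇒≥ u≮v))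
  ...   | refl = contradiction (trans (sym e) (Adj-irrefl Γ u)) λ ()

  pairing-arcSum : ∀ {es} → InGraph (Adj Γ) es →
                   pairing (λ u v → arcSum (arcChain u v) es) (upper ψ) ≡ arcSum ψ es [mod N ]
  pairing-arcSum []       = ≡⇒≡mod (sum-zero n λ u → sum-zero n λ v → ℤ.*-zeroˡ (upper ψ u v))
  pairing-arcSum {(a , b) ∷ es} (e ∷ es∈Γ) = begin
    pairing (λ u v → arcChain u v a b + arcSum (arcChain u v) es) (upper ψ)
      ≡⟨ pairing-+ˡ (λ u v → arcChain u v a b) (λ u v → arcSum (arcChain u v) es) (upper ψ) ⟩
    pairing (λ u v → arcChain u v a b) (upper ψ) + pairing (λ u v → arcSum (arcChain u v) es) (upper ψ)
      ≈⟨ +-cong-mod (≡mod-trans (≡⇒≡mod (pairing-arcChain a b (upper ψ))) (upper-antisymmetrised a b e))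
                    (pairing-arcSum es∈Γ) ⟩
    ψ a b + arcSum ψ es ∎
    where open ≡mod-Reasoning N

  pairing-chainW : ∀ w → IsWalkIn (Adj Γ) w → pairing (chainW w) (upper ψ) ≡ arcSum ψ (arcsW w) [mod N ]
  pairing-chainW w w∈Γ = ≡mod-trans
    (≡⇒≡mod (sum-cong λ u → sum-cong λ v → cong (_* upper ψ u v) (chainW-arcSum w u v)))
    (pairing-arcSum w∈Γ)

  -- All walk sums are values of one functional, pairing with `upper ψ`, and that functional is
  -- linear in the chain.
  arcSum-homology : (w : Walk n) (L : Fin t → Walk n) (c : Fin t → ℤ) →
    IsWalkIn (Adj Γ) w → (∀ j → IsWalkIn (Adj Γ) (L j)) →
    (∀ u v → chainW w u v ≡ sumℤ t (λ j → c j * chainW (L j) u v)) →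
    arcSum ψ (arcsW w) ≡ sumℤ t (λ j → c j * arcSum ψ (arcsW (L j))) [mod N ]
  arcSum-homology {t} w L c w∈Γ L∈Γ eq = begin
    arcSum ψ (arcsW w)                                          ≈⟨ pairing-chainW w w∈Γ ⟨
    pairing (chainW w) (upper ψ)
      ≡⟨ sum-cong (λ u → sum-cong (λ v → cong (_* upper ψ u v) (eq u v))) ⟩
    pairing (λ u v → sumℤ t (λ j → c j * chainW (L j) u v)) (upper ψ)
      ≡⟨ pairing-combination c (chainW ∘ L) (upper ψ) ⟩
    sumℤ t (λ j → c j * pairing (chainW (L j)) (upper ψ))
      ≈⟨ sum-cong-mod (λ j → *-congˡ-mod (c j) (pairing-chainW (L j) (L∈Γ j))) ⟩
    sumℤ t (λ j → c j * arcSum ψ (arcsW (L j)))                 ∎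
    where open ≡mod-Reasoning N

-- Finite order and coset representatives

iterate-+ : (h : X → X) (x : X) → ∀ i j → iterate h x (i ℕ.+ j) ≡ iterate h (iterate h x i) j
iterate-+ h x zero    j = refl
iterate-+ h x (suc i) j = iterate-+ h (h x) i j

iterate-suc : (h : X → X) (x : X) → ∀ i → h (iterate h x i) ≡ iterate h x (suc i)
iterate-suc h x zero    = refl
iterate-suc h x (suc i) = iterate-suc h (h x) i

iterate-injective : {h : X → X} → Injective _≡_ _≡_ h → ∀ i → Injective _≡_ _≡_ (λ x → iterate h x i)
iterate-injective inj zero    eq = eq
iterate-injective inj (suc i) eq = inj (iterate-injective inj i eq)

iterate-* : (h : X → X) (x : X) → ∀ d → iterate h x d ≡ x → ∀ q → iterate h x (q ℕ.* d) ≡ x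
iterate-* h x d eq zero    = refl
iterate-* h x d eq (suc q) =
  trans (iterate-+ h x d (q ℕ.* d)) (trans (cong (λ z → iterate h z (q ℕ.* d)) eq) (iterate-* h x d eq q))

module _ {h : Fin n → Fin n} (inj : Injective _≡_ _≡_ h) where
  -- Two of the first n + 1 iterates coincide, and injectivity strips off the iterations they share.
  period : ∀ x → ∃ λ d → ℕ.NonZero d × iterate h x d ≡ x
  period x with Fin.pigeonhole (ℕ.n<1+n n) (λ i → iterate h x (toℕ i))
  ... | i , j , i<j , eq = toℕ j ∸ toℕ i , ℕ.>-nonZero (ℕ.m<n⇒0<n∸m i<j) ,
    iterate-injective inj (toℕ i) (begin
      iterate h (iterate h x (toℕ j ∸ toℕ i)) (toℕ i)  ≡⟨ iterate-+ h x (toℕ j ∸ toℕ i) (toℕ i) ⟨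
      iterate h x (toℕ j ∸ toℕ i ℕ.+ toℕ i)            ≡⟨ cong (iterate h x) (ℕ.m∸n+n≡m (ℕ.<⇒≤ i<j)) ⟩
      iterate h x (toℕ j)                              ≡⟨ eq ⟨
      iterate h x (toℕ i)                              ∎)
    where open ≡-Reasoning

  abstract
    -- The product of the periods of all points is a common period. It is given as a successor
    -- because the m-th iterate is then the inverse.
    finiteOrder : ∃ λ m → ∀ x → iterate h x (suc m) ≡ x
    finiteOrder = ℕ.pred M , λ x → trans (cong (iterate h x) (ℕ.suc-pred M)) (M-period x)
      where
      M : ℕ
      M = product (tabulate (proj₁ ∘ period))
      instance
        M≢0 : ℕ.NonZero M
        M≢0 = product≢0 (All.tabulate⁺ (proj₁ ∘ proj₂ ∘ period))
      M-period : ∀ x → iterate h x M ≡ x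
      M-period x with ∈⇒∣product (∈-tabulate⁺ {f = proj₁ ∘ period} x)
      ... | ∣.divides q eq =
        trans (cong (iterate h x) eq) (iterate-* h x (proj₁ (period x)) (proj₂ (proj₂ (period x))) q)

-- Finite lists meeting every class, and search in them

Covers : Rel X 0ℓ → List X → Set
Covers _∼_ xs = ∀ x → Any (x ∼_) xs

residues : ℕ → List ℤ
residues N = map +_ (upTo N)

residues-covers : ∀ N .{{_ : ℕ.NonZero N}} → Covers (_≡_[mod N ]) (residues N)
residues-covers N x = lose (∈-map⁺ +_ (∈-upTo⁺ (n%ℕd<d x N)))
  (∣⇒≡mod (divides (x /ℕ N) (trans (cong (_- + (x %ℕ N)) (a≡a%ℕn+[a/ℕn]*n x N)) (lemma (+ (x %ℕ N)) _))))
  where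
  lemma : ∀ r z → r + z - r ≡ z
  lemma = solve-∀

functionCons : {Y : Fin (suc n) → Set} → Y zero → (∀ i → Y (suc i)) → ∀ i → Y i
functionCons y ys zero    = y
functionCons y ys (suc i) = ys i

functions : {Y : Fin n → Set} → (∀ i → List (Y i)) → List (∀ i → Y i)
functions {zero}  yss = [ (λ ()) ]
functions {suc n} yss = cartesianProductWith functionCons (yss zero) (functions (yss ∘ suc))

functions-covers : {Y : Fin n → Set} {_∼_ : ∀ {i} → Rel (Y i) 0ℓ} {yss : ∀ i → List (Y i)} →
                   (∀ i → Covers _∼_ (yss i)) → Covers (λ h h′ → ∀ i → h i ∼ h′ i) (functions yss)
functions-covers {zero}  cov h = here λ ()
functions-covers {suc n} cov h =
  Any.cartesianProductWith⁺ functionCons (λ { e es zero → e ; e es (suc i) → es i })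
    (cov zero (h zero)) (functions-covers (cov ∘ suc) (h ∘ suc))

module _ {P : Pred X 0ℓ} (P? : Decidable P) (default : X) where
  first : List X → X
  first []       = default
  first (x ∷ xs) = if does (P? x) then x else first xs

  first-satisfies : ∀ {xs} → Any P xs → P (first xs)
  first-satisfies {x ∷ xs} any with P? x
  ... | yes px = px
  first-satisfies (here px)   | no ¬px = contradiction px ¬px
  first-satisfies (there any) | no _   = first-satisfies any

-- Only the outcomes of the tests matter, so equivalent predicates select the identical element, not
-- merely a congruent one.
first-cong : {P Q : Pred X 0ℓ} (P? : Decidable P) (Q? : Decidable Q) (default : X) →
             (∀ x → P x → Q x) → (∀ x → Q x → P x) → ∀ xs → first P? default xs ≡ first Q? default xs
first-cong P? Q? d P⇒Q Q⇒P []       = refl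
first-cong P? Q? d P⇒Q Q⇒P (x ∷ xs) with P? x | Q? x
... | yes _ | yes _  = refl
... | yes p | no ¬q  = contradiction (P⇒Q x p) ¬q
... | no ¬p | yes q  = contradiction (Q⇒P x q) ¬p
... | no _  | no _   = first-cong P? Q? d P⇒Q Q⇒P xs

module Elements (σ : Shape) where
  infix 4 _≋_
  record _≋_ (x y : Elt σ) : Set where
    constructor pointwise
    field at : ∀ γ η → x γ η ≡ y γ η [mod p σ γ ^ k σ γ η ]
  open _≋_ public

  EqA⇒≋ : ∀ {x y} → EqA σ x y → x ≋ y
  EqA⇒≋ e = pointwise λ γ η → congruent (e γ η)

  ≋⇒EqA : ∀ {x y} → x ≋ y → EqA σ x y
  ≋⇒EqA e γ η = _≡_[mod_].difference (at e γ η)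

  ≋-refl : ∀ {x} → x ≋ x
  ≋-refl = pointwise λ γ η → ≡mod-refl

  ≋-sym : ∀ {x y} → x ≋ y → y ≋ x
  ≋-sym e = pointwise λ γ η → ≡mod-sym (at e γ η)

  ≋-trans : ∀ {x y z} → x ≋ y → y ≋ z → x ≋ z
  ≋-trans e e′ = pointwise λ γ η → ≡mod-trans (at e γ η) (at e′ γ η)

  ≋-dec : ∀ x y → Dec (x ≋ y)
  ≋-dec x y = Dec.map′ pointwise at (Fin.all? λ γ → Fin.all? λ η → ≡mod-dec _ (x γ η) (y γ η))

  infixl 6 _⊕_
  _⊕_ : Elt σ → Elt σ → Elt σ
  _⊕_ = addA σ

  combination : ((γ : Fin (g σ)) → Mat t (suc (a σ γ))) → (Fin t → ℤ) → Elt σ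
  combination θ c γ η = (c ∙ θ γ) η

module _ {σ : Shape} (primary : IsPrimaryShape σ) (θ : (γ : Fin (g σ)) → Mat t (suc (a σ γ))) where
  open IsPrimaryShape primary
  open Elements σ

  private
    -- A common multiple of all moduli: coefficients matter only modulo it, so finitely many
    -- coefficient vectors exhaust the local group.
    exponent : ℕ
    exponent = product (tabulate (λ γ → p σ γ ^ Kγ σ γ))

    instance
      p≢0 : ∀ {γ} → ℕ.NonZero (p σ γ)
      p≢0 {γ} = prime⇒nonZero (prime γ)

      exponent≢0 : ℕ.NonZero exponent
      exponent≢0 = product≢0 (All.tabulate⁺ {f = λ γ → p σ γ ^ Kγ σ γ} λ γ → ℕ.m^n≢0 (p σ γ) (Kγ σ γ))

    elements : List (Elt σ)
    elements = functions λ γ → functions λ η → residues (p σ γ ^ k σ γ η)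

    elements-covers : ∀ x → Any (x ≋_) elements
    elements-covers x = Any.map pointwise (functions-covers
      {_∼_ = λ {γ} h h′ → ∀ η → h η ≡ h′ η [mod p σ γ ^ k σ γ η ]}
      (λ γ → functions-covers {_∼_ = λ {η} y y′ → y ≡ y′ [mod p σ γ ^ k σ γ η ]} λ η →
        residues-covers (p σ γ ^ k σ γ η) {{ℕ.m^n≢0 (p σ γ) (k σ γ η)}}) x)

    coefficients : List (Fin t → ℤ)
    coefficients = functions λ _ → residues exponent

    coefficients-covers : ∀ c → Any (λ d → ∀ i → c i ≡ d i [mod exponent ]) coefficients
    coefficients-covers = functions-covers λ _ → residues-covers exponent

    reduce-exponent : ∀ {x y} γ η → x ≡ y [mod exponent ] → x ≡ y [mod p σ γ ^ k σ γ η ]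
    reduce-exponent γ η e = congruent (∣.∣-trans (∣.∣-trans (^-∣ (p σ γ) (k≤K primary γ η))
      (∈⇒∣product (∈-tabulate⁺ {f = λ γ → p σ γ ^ Kγ σ γ} γ))) (_≡_[mod_].difference e))

    -- Quantifying over the finite list makes coset membership decidable; `inCoset` recovers
    -- arbitrary integer coefficients.
    InCoset : Elt σ → Elt σ → Set
    InCoset x ρ = Any (λ c → x ≋ ρ ⊕ combination θ c) coefficients

    inCoset? : ∀ x → Decidable (InCoset x)
    inCoset? x ρ = Any.any? (λ c → ≋-dec x (ρ ⊕ combination θ c)) coefficients

    inCoset : ∀ {x} ρ c → x ≋ ρ ⊕ combination θ c → InCoset x ρ
    inCoset ρ c e = Any.map (λ c≡d → ≋-trans e (pointwise λ γ η →
      +-cong-mod (≡mod-refl {ρ γ η}) (∙-congˡ-mod (θ γ) (λ i → reduce-exponent γ η (c≡d i)) η)))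
      (coefficients-covers c)

    inCoset-shift : ∀ x y ρ c → x ≋ y ⊕ combination θ c → InCoset x ρ → InCoset y ρ
    inCoset-shift x y ρ c e x∈ρ = let d , e′ = Any.satisfied x∈ρ in
      inCoset ρ (λ i → d i + - 1ℤ * c i) (pointwise λ γ η → let open ≡mod-Reasoning (p σ γ ^ k σ γ η) in begin
        y γ η                                              ≡⟨ lemma (y γ η) ((c ∙ θ γ) η) ⟩
        y γ η + (c ∙ θ γ) η + - 1ℤ * (c ∙ θ γ) η
          ≈⟨ +-cong-mod (≡mod-trans (≡mod-sym (at e γ η)) (at e′ γ η)) ≡mod-refl ⟩
        ρ γ η + (d ∙ θ γ) η + - 1ℤ * (c ∙ θ γ) η           ≡⟨ ℤ.+-assoc (ρ γ η) _ _ ⟩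
        ρ γ η + ((d ∙ θ γ) η + - 1ℤ * (c ∙ θ γ) η)
          ≡⟨ cong₂ _+_ {x = ρ γ η} refl (trans (∙-+ d (λ i → - 1ℤ * c i) (θ γ) η)
               (cong₂ _+_ {x = (d ∙ θ γ) η} refl (∙-* (- 1ℤ) c (θ γ) η))) ⟨
        ρ γ η + ((λ i → d i + - 1ℤ * c i) ∙ θ γ) η         ∎)
      where
      lemma : ∀ x y → x ≡ x + y + - 1ℤ * y
      lemma = solve-∀

  abstract
    -- The default is never reached: the list contains an element congruent to `x`, which lies in
    -- its coset.
    representative : Elt σ → Elt σ
    representative x = first (inCoset? x) (zeroA σ) elements

    private
      inCoset-representative : ∀ x → InCoset x (representative x)
      inCoset-representative x = first-satisfies (inCoset? x) (zeroA σ)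
        (Any.map (λ {ρ} e → inCoset ρ (λ _ → 0ℤ) (≋-trans e (pointwise λ γ η →
          ≡⇒≡mod (sym (trans (cong₂ _+_ {x = ρ γ η} refl (∙-zeroˡ (θ γ) η)) (ℤ.+-identityʳ (ρ γ η)))))))
        (elements-covers x))

    coordinates : Elt σ → Fin t → ℤ
    coordinates x = proj₁ (Any.satisfied (inCoset-representative x))

    representative-coordinates : ∀ x → x ≋ representative x ⊕ combination θ (coordinates x)
    representative-coordinates x = proj₂ (Any.satisfied (inCoset-representative x))

    -- Elements of one coset satisfy the same membership predicate, so both searches stop at the
    -- same entry.
    representative-≡ : ∀ x y c → x ≋ y ⊕ combination θ c → representative x ≡ representative y
    representative-≡ x y c e = first-cong (inCoset? x) (inCoset? y) (zeroA σ)
      (λ ρ → inCoset-shift x y ρ c e)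
      (λ ρ → inCoset-shift y x ρ (λ i → - 1ℤ * c i) (pointwise λ γ η → ≡mod-trans
        (≡⇒≡mod (trans (lemma (y γ η) ((c ∙ θ γ) η))
          (cong₂ _+_ {x = y γ η + (c ∙ θ γ) η} refl (sym (∙-* (- 1ℤ) c (θ γ) η)))))
        (+-cong-mod (≡mod-sym (at e γ η)) ≡mod-refl)))
      elements
      where
      lemma : ∀ x y → x ≡ x + y + - 1ℤ * y
      lemma = solve-∀

-- Lifting

-- On each coset ρ + ⟨θ⟩ of the subgroup generated by θ, with ρ its chosen representative,
-- twist is the map ρ + c ∙ θ ↦ ρ + c ∙ S ∙ θ.
module Twist {σ : Shape} (primary : IsPrimaryShape σ) (θ : (γ : Fin (g σ)) → Mat t (suc (a σ γ)))
             (S : Mat t t) (invariant : ∀ c → InKernel primary θ c → InKernel primary θ (c ∙ S)) where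
  open Elements σ

  private
    rep = representative primary θ
    coord = coordinates primary θ
    comb = combination θ

    minus : (Fin t → ℤ) → (Fin t → ℤ) → Fin t → ℤ
    minus c d i = c i + - 1ℤ * d i

    ∙-minus : ∀ c d (X : Mat t m) → minus c d ∙ X ≗ λ j → (c ∙ X) j + - 1ℤ * (d ∙ X) j
    ∙-minus c d X j = trans (∙-+ c (λ i → - 1ℤ * d i) X j) (cong₂ _+_ {x = (c ∙ X) j} refl (∙-* (- 1ℤ) d X j))

  -- Invariance of the kernel, applied to c - d, says exactly that `S` acts on the values of
  -- combinations and not only on coefficient vectors.
  combination-∙-cong : ∀ c d → comb c ≋ comb d → comb (c ∙ S) ≋ comb (d ∙ S)
  combination-∙-cong c d e = pointwise λ γ η → let open ≡mod-Reasoning (p σ γ ^ k σ γ η) in begin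
    (c ∙ S ∙ θ γ) η                                               ≡⟨ add-sub _ ((d ∙ S ∙ θ γ) η) ⟩
    (c ∙ S ∙ θ γ) η + - 1ℤ * (d ∙ S ∙ θ γ) η + (d ∙ S ∙ θ γ) η    ≡⟨ cong (_+ (d ∙ S ∙ θ γ) η)
        (trans (∙-congˡ (θ γ) (∙-minus c d S) η) (trans (∙-+ (c ∙ S) (λ i → - 1ℤ * (d ∙ S) i) (θ γ) η)
          (cong₂ _+_ {x = (c ∙ S ∙ θ γ) η} refl (∙-* (- 1ℤ) (d ∙ S) (θ γ) η)))) ⟨
    (minus c d ∙ S ∙ θ γ) η + (d ∙ S ∙ θ γ) η
      ≈⟨ +-cong-mod (invariant (minus c d) kernel γ η) ≡mod-refl ⟩
    0ℤ + (d ∙ S ∙ θ γ) η                                          ≡⟨ ℤ.+-identityˡ _ ⟩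
    (d ∙ S ∙ θ γ) η                                               ∎
    where
    add-sub : ∀ x y → x ≡ x + - 1ℤ * y + y
    add-sub = solve-∀
    sub-self : ∀ x → x + - 1ℤ * x ≡ 0ℤ
    sub-self = solve-∀
    kernel : InKernel primary θ (minus c d)
    kernel γ η = let open ≡mod-Reasoning (p σ γ ^ k σ γ η) in begin
      (minus c d ∙ θ γ) η                   ≡⟨ ∙-minus c d (θ γ) η ⟩
      (c ∙ θ γ) η + - 1ℤ * (d ∙ θ γ) η      ≈⟨ +-cong-mod (at e γ η) ≡mod-refl ⟩
      (d ∙ θ γ) η + - 1ℤ * (d ∙ θ γ) η      ≡⟨ sub-self ((d ∙ θ γ) η) ⟩
      0ℤ                                    ∎

  twist : Elt σ → Elt σ
  twist x = rep x ⊕ comb (coord x ∙ S)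

  -- Frees `twist` from the coordinates chosen in its definition: any coefficients relative to the
  -- same base point will do.
  twist-coset : ∀ x y c → y ≋ rep x ⊕ comb c → twist y ≋ rep x ⊕ comb (c ∙ S)
  twist-coset x y c e = pointwise λ γ η →
    +-cong-mod (≡⇒≡mod (cong (λ ρ → ρ γ η) rep-y≡rep-x)) (at (combination-∙-cong (coord y) c coord-y≋c) γ η)
    where
    rep-y≡rep-x : rep y ≡ rep x
    rep-y≡rep-x = representative-≡ primary θ y x (minus c (coord x)) (pointwise λ γ η →
      let open ≡mod-Reasoning (p σ γ ^ k σ γ η) in begin
      y γ η                                                 ≈⟨ at e γ η ⟩
      rep x γ η + (c ∙ θ γ) η
        ≡⟨ lemma (rep x γ η) ((c ∙ θ γ) η) ((coord x ∙ θ γ) η) ⟩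
      rep x γ η + (coord x ∙ θ γ) η + ((c ∙ θ γ) η + - 1ℤ * (coord x ∙ θ γ) η)
        ≈⟨ +-cong-mod (at (representative-coordinates primary θ x) γ η)
                      (≡⇒≡mod (∙-minus c (coord x) (θ γ) η)) ⟨
      x γ η + (minus c (coord x) ∙ θ γ) η                   ∎)
      where
      lemma : ∀ r c d → r + c ≡ r + d + (c + - 1ℤ * d)
      lemma = solve-∀
    coord-y≋c : comb (coord y) ≋ comb c
    coord-y≋c = pointwise λ γ η → +-cancelˡ-mod (rep x γ η)
      (subst (λ ρ → ρ γ η + comb (coord y) γ η ≡ rep x γ η + comb c γ η [mod p σ γ ^ k σ γ η ]) rep-y≡rep-x
        (≡mod-trans (≡mod-sym (at (representative-coordinates primary θ y) γ η)) (at e γ η)))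

  twist-cong : ∀ {x y} → x ≋ y → twist x ≋ twist y
  twist-cong {x} {y} e = twist-coset y x (coord y) (≋-trans e (representative-coordinates primary θ y))

  -- Equivariance under the local group. The voltage of every arc is such a combination, so this is
  -- what carries edges to edges.
  twist-⊕ : ∀ x y c → x ≋ y ⊕ comb c → twist x ≋ twist y ⊕ comb (c ∙ S)
  twist-⊕ x y c e = ≋-trans (twist-coset y x (λ i → coord y i + c i) x≋) (pointwise λ γ η → ≡⇒≡mod (begin
      rep y γ η + ((λ i → coord y i + c i) ∙ S ∙ θ γ) η
        ≡⟨ cong₂ _+_ {x = rep y γ η} refl (trans (∙-congˡ (θ γ) (∙-+ (coord y) c S) η)
                                             (∙-+ (coord y ∙ S) (c ∙ S) (θ γ) η)) ⟩
      rep y γ η + ((coord y ∙ S ∙ θ γ) η + (c ∙ S ∙ θ γ) η)  ≡⟨ ℤ.+-assoc (rep y γ η) _ _ ⟨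
      rep y γ η + (coord y ∙ S ∙ θ γ) η + (c ∙ S ∙ θ γ) η    ∎))
    where
    open ≡-Reasoning
    x≋ : x ≋ rep y ⊕ comb (λ i → coord y i + c i)
    x≋ = pointwise λ γ η → ≡mod-trans (at e γ η)
      (≡mod-trans (+-cong-mod (at (representative-coordinates primary θ y) γ η) ≡mod-refl)
        (≡⇒≡mod (trans (ℤ.+-assoc (rep y γ η) _ _)
          (cong₂ _+_ {x = rep y γ η} refl (sym (∙-+ (coord y) c (θ γ) η))))))

  iterate-twist : ∀ r x y c → y ≋ rep x ⊕ comb c → iterate twist y r ≋ rep x ⊕ comb (iterate (_∙ S) c r)
  iterate-twist zero    x y c e = e
  iterate-twist (suc r) x y c e = iterate-twist r x (twist y) (c ∙ S) (twist-coset x y c e)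

  iterate-twist-cong : ∀ r {x y} → x ≋ y → iterate twist x r ≋ iterate twist y r
  iterate-twist-cong zero    e = e
  iterate-twist-cong (suc r) e = iterate-twist-cong r (twist-cong e)

  module _ (r : ℕ) (periodic : ∀ c → comb (iterate (_∙ S) c (suc r)) ≋ comb c) where
    -- Iteration never leaves the coset and keeps its base point, so the orbit of `x` follows the
    -- powers of `S` on the coordinates.
    twist-periodic : ∀ x → iterate twist x (suc r) ≋ x
    twist-periodic x = ≋-trans (iterate-twist (suc r) x x (coord x) (representative-coordinates primary θ x))
      (≋-trans (pointwise λ γ η → +-cong-mod (≡mod-refl {rep x γ η}) (at (periodic (coord x)) γ η))
               (≋-sym (representative-coordinates primary θ x)))

    twist-injective : ∀ {x y} → twist x ≋ twist y → x ≋ y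
    twist-injective {x} {y} e =
      ≋-trans (≋-sym (twist-periodic x)) (≋-trans (iterate-twist-cong r e) (twist-periodic y))

module Lifting {Γ : Graph n} {Tr : Fin n → Fin n → Bool} (tree : IsSpanningTree Γ Tr)
  (v₀ : Fin n) (W : Fin n → Fin n → Walk n) (W-tree : ∀ x y → IsTreeWalk Tr x y (W x y))
  (h : Fin t → Fin n × Fin n) (cotree : IsCotreeArcs Γ Tr h)
  {σ : Shape} (primary : IsPrimaryShape σ)
  (φ : Voltage n σ) (φ-voltage : IsVoltage Γ φ) (φ-reduced : IsTReduced Tr φ)
  (α : Permutation′ n) (α-aut : IsAut Γ α)
  (S : Mat t t) (S-homology : IsHomologyMatrix α (basicWalk v₀ W h) S) where
  open Elements σ
  open IsSpanningTree tree

  L : Fin t → Walk n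
  L = basicWalk v₀ W h

  θ : (γ : Fin (g σ)) → Mat t (suc (a σ γ))
  θ γ i η = voltW φ (L i) γ η

  α̂ : Fin n → Fin n
  α̂ = α ⟨$⟩ʳ_

  -- The voltage pulled back along α^r: its sum along a walk is the voltage of the image of the walk
  -- under α^r.
  ν : ℕ → ∀ γ → Fin (suc (a σ γ)) → ArcFun n
  ν r γ η u v = vol φ (iterate α̂ u r) (iterate α̂ v r) γ η

  θ⟨_⟩ : ℕ → (γ : Fin (g σ)) → Mat t (suc (a σ γ))
  θ⟨ r ⟩ γ i η = arcSum (ν r γ η) (arcsW (L i))

  θ≡θ⟨0⟩ : ∀ γ i η → θ γ i η ≡ θ⟨ 0 ⟩ γ i η
  θ≡θ⟨0⟩ γ i η = voltage-arcSum (arcsW (L i))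
    where
    voltage-arcSum : ∀ es → foldr (λ e → addA σ (vol φ (proj₁ e) (proj₂ e))) (zeroA σ) es γ η
                            ≡ arcSum (ν 0 γ η) es
    voltage-arcSum []             = refl
    voltage-arcSum ((u , v) ∷ es) = cong₂ _+_ {x = vol φ u v γ η} refl (voltage-arcSum es)

  iterate-Adj : ∀ r u v → Adj Γ u v ≡ true → Adj Γ (iterate α̂ u r) (iterate α̂ v r) ≡ true
  iterate-Adj zero    u v e = e
  iterate-Adj (suc r) u v e = iterate-Adj r (α̂ u) (α̂ v) (trans (α-aut u v) e)

  ν-antisymmetric : ∀ r γ η → Antisymmetric (p σ γ ^ k σ γ η) (Adj Γ) (ν r γ η)
  ν-antisymmetric r γ η u v e = congruent (φ-voltage _ _ (iterate-Adj r u v e) γ η)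

  ν-antisymmetric-tree : ∀ r γ η → Antisymmetric (p σ γ ^ k σ γ η) Tr (ν r γ η)
  ν-antisymmetric-tree r γ η u v e = ν-antisymmetric r γ η u v (sub u v e)

  treePath : Fin n → Fin n → List (Fin n)
  treePath x y = rest (W x y)

  treePath-last : ∀ x y → lastV x (treePath x y) ≡ y
  treePath-last x y with W x y | W-tree x y
  ... | walk _ _ | refl , end , _ = end

  treePath-inTree : ∀ x y → InGraph Tr (arcsFrom x (treePath x y))
  treePath-inTree x y with W x y | W-tree x y
  ... | walk _ _ | refl , _ , inTr , _ = inTr

  toTree : ArcFun n → Fin n → ℤ
  toTree ψ x = pathSum ψ v₀ (treePath v₀ x)

  fromTree : ArcFun n → Fin n → ℤ
  fromTree ψ x = pathSum ψ x (treePath x v₀)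

  fundamentalPath : Fin n → Fin n → List (Fin n)
  fundamentalPath u v = treePath v₀ u ++ v ∷ treePath v v₀

  fundamentalPath-arcs : ∀ u v → arcsFrom v₀ (fundamentalPath u v) ≡
    arcsFrom v₀ (treePath v₀ u) ++ (u , v) ∷ arcsFrom v (treePath v v₀)
  fundamentalPath-arcs u v = trans (arcsFrom-++ v₀ (treePath v₀ u) (v ∷ treePath v v₀))
    (cong (λ z → arcsFrom v₀ (treePath v₀ u) ++ (z , v) ∷ arcsFrom v (treePath v v₀)) (treePath-last v₀ u))

  fundamentalPath-closed : ∀ u v → lastV v₀ (fundamentalPath u v) ≡ v₀
  fundamentalPath-closed u v = trans (lastV-++ v₀ (treePath v₀ u) (v ∷ treePath v v₀)) (treePath-last v v₀)

  fundamentalPath-sum : ∀ ψ u v → pathSum ψ v₀ (fundamentalPath u v) ≡ toTree ψ u + (ψ u v + fromTree ψ v)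
  fundamentalPath-sum ψ u v =
    trans (cong (arcSum ψ) (fundamentalPath-arcs u v)) (arcSum-++ ψ (arcsFrom v₀ (treePath v₀ u)) _)

  L-inΓ : ∀ i → IsWalkIn (Adj Γ) (L i)
  L-inΓ i = subst (InGraph (Adj Γ)) (sym (fundamentalPath-arcs u v))
    (All.++⁺ (tree⇒Γ (treePath-inTree v₀ u)) (IsCotreeArcs.isEdge cotree i ∷ tree⇒Γ (treePath-inTree v v₀)))
    where
    u = proj₁ (h i)
    v = proj₂ (h i)
    tree⇒Γ : ∀ {es} → InGraph Tr es → InGraph (Adj Γ) es
    tree⇒Γ = All.map (sub _ _)

  -- The (r+1)-st pullback along `L i` is the r-th pullback along `mapWalk α̂ (L i)`, whose chain
  -- `S` expresses through the chains of the `L j`. Pullbacks stay antisymmetric since `α` preserves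
  -- adjacency.
  θ⟨suc⟩ : ∀ r γ i η → θ⟨ suc r ⟩ γ i η ≡ (S · θ⟨ r ⟩ γ) i η [mod p σ γ ^ k σ γ η ]
  θ⟨suc⟩ r γ i η = ≡mod-trans
    (≡⇒≡mod (sym (pathSum-map (ν r γ η) α̂ v₀ (rest (L i)))))
    (arcSum-homology Γ (ν-antisymmetric r γ η) (mapWalk α̂ (L i)) L (S i)
      (inGraph-map α̂ (λ u v e → trans (α-aut u v) e) v₀ (rest (L i)) (L-inΓ i)) L-inΓ (S-homology i))

  ∙S∙θ : ∀ c γ η → (c ∙ S ∙ θ γ) η ≡ (c ∙ θ⟨ 1 ⟩ γ) η [mod p σ γ ^ k σ γ η ]
  ∙S∙θ c γ η = begin
    (c ∙ S ∙ θ γ) η        ≈⟨ ∙-congʳ-mod (c ∙ S) (λ i j → ≡⇒≡mod (θ≡θ⟨0⟩ γ i j)) η ⟩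
    (c ∙ S ∙ θ⟨ 0 ⟩ γ) η   ≡⟨ ∙-assoc c S (θ⟨ 0 ⟩ γ) η ⟩
    (c ∙ (S · θ⟨ 0 ⟩ γ)) η ≈⟨ sum-cong-mod (λ i → *-congˡ-mod (c i) (θ⟨suc⟩ 0 γ i η)) ⟨
    (c ∙ θ⟨ 1 ⟩ γ) η       ∎
    where open ≡mod-Reasoning (p σ γ ^ k σ γ η)

  iterate-S : ∀ r q c γ η → (iterate (_∙ S) c r ∙ θ⟨ q ⟩ γ) η ≡ (c ∙ θ⟨ r ℕ.+ q ⟩ γ) η [mod p σ γ ^ k σ γ η ]
  iterate-S zero    q c γ η = ≡mod-refl
  iterate-S (suc r) q c γ η = begin
    (iterate (_∙ S) (c ∙ S) r ∙ θ⟨ q ⟩ γ) η  ≈⟨ iterate-S r q (c ∙ S) γ η ⟩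
    (c ∙ S ∙ θ⟨ r ℕ.+ q ⟩ γ) η               ≡⟨ ∙-assoc c S (θ⟨ r ℕ.+ q ⟩ γ) η ⟩
    (c ∙ (S · θ⟨ r ℕ.+ q ⟩ γ)) η
      ≈⟨ sum-cong-mod (λ i → *-congˡ-mod (c i) (θ⟨suc⟩ (r ℕ.+ q) γ i η)) ⟨
    (c ∙ θ⟨ suc r ℕ.+ q ⟩ γ) η               ∎
    where open ≡mod-Reasoning (p σ γ ^ k σ γ η)

  α̂-injective : ∀ {u v} → α̂ u ≡ α̂ v → u ≡ v
  α̂-injective {u} {v} e = trans (sym (inverseˡ α)) (trans (cong (α ⟨$⟩ˡ_) e) (inverseˡ α))

  r₀ : ℕ
  r₀ = proj₁ (finiteOrder α̂-injective)

  -- The powers of `S` are compared through voltages: at the order of `α` the pulled-back voltage is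
  -- the original one.
  S-periodic : ∀ c → combination θ (iterate (_∙ S) c (suc r₀)) ≋ combination θ c
  S-periodic c = pointwise λ γ η → let open ≡mod-Reasoning (p σ γ ^ k σ γ η) in begin
    (iterate (_∙ S) c (suc r₀) ∙ θ γ) η
      ≡⟨ sum-cong (λ i → cong (iterate (_∙ S) c (suc r₀) i *_) (θ≡θ⟨0⟩ γ i η)) ⟩
    (iterate (_∙ S) c (suc r₀) ∙ θ⟨ 0 ⟩ γ) η   ≈⟨ iterate-S (suc r₀) 0 c γ η ⟩
    (c ∙ θ⟨ suc r₀ ℕ.+ 0 ⟩ γ) η                ≡⟨ cong (λ r → (c ∙ θ⟨ r ⟩ γ) η) (ℕ.+-identityʳ (suc r₀)) ⟩
    (c ∙ θ⟨ suc r₀ ⟩ γ) η                      ≈⟨ sum-cong-mod (λ i → *-congˡ-mod (c i)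
                                                    (arcSum-cong (λ u v _ → ν-periodic γ η u v) (L-inΓ i))) ⟩
    (c ∙ θ⟨ 0 ⟩ γ) η                           ≡⟨ sum-cong (λ i → cong (c i *_) (θ≡θ⟨0⟩ γ i η)) ⟨
    (c ∙ θ γ) η                                ∎
    where
    ν-periodic : ∀ γ η u v → ν (suc r₀) γ η u v ≡ ν 0 γ η u v [mod p σ γ ^ k σ γ η ]
    ν-periodic γ η u v = ≡⇒≡mod (cong₂ (λ u v → vol φ u v γ η)
      (proj₂ (finiteOrder α̂-injective) u) (proj₂ (finiteOrder α̂-injective) v))

  module FromLift (lift : Lifts Γ φ α) where
    private
      F = proj₁ lift

    fibre : Fin n → Elt σ → Elt σ
    fibre u x = proj₂ (f F (u , x))

    fibre-cong : ∀ u {x y} → x ≋ y → fibre u x ≋ fibre u y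
    fibre-cong u {x} {y} e = EqA⇒≋ (proj₂ (f-cong F (u , x) (u , y) (refl , ≋⇒EqA e)))

    fibre-arc : ∀ u v → Adj Γ u v ≡ true → ∀ x → fibre v (vol φ u v ⊕ x) ≋ vol φ (α̂ u) (α̂ v) ⊕ fibre u x
    fibre-arc u v e x with adj⇒ F (u , x) (v , vol φ u v ⊕ x) (e , ≋⇒EqA (≋-refl {vol φ u v ⊕ x}))
    ... | _ , e′ rewrite proj₂ lift (u , x) | proj₂ lift (v , vol φ u v ⊕ x) = EqA⇒≋ e′

    fibre-path : ∀ u us → InGraph (Adj Γ) (arcsFrom u us) → ∀ x →
      fibre (lastV u us) ((λ γ η → pathSum (ν 0 γ η) u us) ⊕ x) ≋ (λ γ η → pathSum (ν 1 γ η) u us) ⊕ fibre u x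
    fibre-path u []       []       x = ≋-trans
      (fibre-cong u (pointwise λ γ η → ≡⇒≡mod (ℤ.+-identityˡ (x γ η))))
      (pointwise λ γ η → ≡⇒≡mod (sym (ℤ.+-identityˡ (fibre u x γ η))))
    fibre-path u (v ∷ us) (e ∷ es) x = ≋-trans
      (fibre-cong (lastV v us) (pointwise λ γ η →
        ≡⇒≡mod (lemma (ν 0 γ η u v) (pathSum (ν 0 γ η) v us) (x γ η))))
      (≋-trans (fibre-path v us es (vol φ u v ⊕ x)) (pointwise λ γ η →
        ≡mod-trans (+-cong-mod (≡mod-refl {pathSum (ν 1 γ η) v us}) (at (fibre-arc u v e x) γ η))
                   (≡⇒≡mod (sym (lemma (ν 1 γ η u v) (pathSum (ν 1 γ η) v us) (fibre u x γ η))))))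
      where
      lemma : ∀ a b c → a + b + c ≡ b + (a + c)
      lemma = solve-∀

    -- Translation by `d` in the fibre over `v₀` becomes translation by `d′` under the lift. Such
    -- pairs form a subgroup of A × A, and each `L i` contributes the pair of its own voltage and
    -- the voltage of its image; integer combinations follow.
    record Shift (d d′ : Elt σ) : Set where
      constructor shift
      field shifts : ∀ x y → y ≋ d ⊕ x → fibre v₀ y ≋ d′ ⊕ fibre v₀ x
    open Shift

    shift-zero : Shift (zeroA σ) (zeroA σ)
    shift-zero = shift λ x y e → pointwise λ γ η → ≡mod-trans
      (at (fibre-cong v₀ (≋-trans e (pointwise λ γ η → ≡⇒≡mod (ℤ.+-identityˡ (x γ η))))) γ η)
      (≡⇒≡mod (sym (ℤ.+-identityˡ (fibre v₀ x γ η))))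

    shift-+ : ∀ {b b′ d d′} → Shift b b′ → Shift d d′ → Shift (b ⊕ d) (b′ ⊕ d′)
    shift-+ {b} {b′} {d} {d′} sb sd = shift λ x y e → ≋-trans
      (shifts sb (d ⊕ x) y (≋-trans e (pointwise λ γ η → ≡⇒≡mod (ℤ.+-assoc (b γ η) (d γ η) (x γ η)))))
      (pointwise λ γ η → ≡mod-trans (+-cong-mod (≡mod-refl {b′ γ η}) (at (shifts sd x (d ⊕ x) ≋-refl) γ η))
        (≡⇒≡mod (sym (ℤ.+-assoc (b′ γ η) (d′ γ η) (fibre v₀ x γ η)))))

    shift-neg : ∀ {d d′} → Shift d d′ → Shift (negA σ d) (negA σ d′)
    shift-neg {d} {d′} sd = shift λ x y e → pointwise λ γ η → ≡mod-sym (≡mod-trans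
      (+-cong-mod (≡mod-refl { - d′ γ η}) (at (shifts sd y x (pointwise λ γ η → ≡mod-trans
        (≡⇒≡mod (lemma (d γ η) (x γ η))) (+-cong-mod (≡mod-refl {d γ η}) (≡mod-sym (at e γ η))))) γ η))
      (≡⇒≡mod (lemma′ (d′ γ η) (fibre v₀ y γ η))))
      where
      lemma : ∀ d x → x ≡ d + (- d + x)
      lemma = solve-∀
      lemma′ : ∀ d x → - d + (d + x) ≡ x
      lemma′ = solve-∀

    shift-resp : ∀ {b b′ d d′} → (∀ γ η → b γ η ≡ d γ η) → (∀ γ η → b′ γ η ≡ d′ γ η) → Shift b b′ → Shift d d′
    shift-resp b≡d b′≡d′ sb = shift λ x y e → ≋-trans
      (shifts sb x y (≋-trans e (pointwise λ γ η → ≡⇒≡mod (cong (_+ x γ η) (sym (b≡d γ η))))))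
      (pointwise λ γ η → ≡⇒≡mod (cong (_+ fibre v₀ x γ η) (b′≡d′ γ η)))

    shift-ℕ* : ∀ {d d′} m → Shift d d′ → Shift (λ γ η → + m * d γ η) (λ γ η → + m * d′ γ η)
    shift-ℕ* {d} {d′} zero sd = shift-resp
      (λ γ η → sym (ℤ.*-zeroˡ (d γ η))) (λ γ η → sym (ℤ.*-zeroˡ (d′ γ η))) shift-zero
    shift-ℕ* {d} {d′} (suc m) sd = shift-resp
      (λ γ η → sym (ℤ.suc-* (+ m) (d γ η))) (λ γ η → sym (ℤ.suc-* (+ m) (d′ γ η)))
      (shift-+ sd (shift-ℕ* m sd))

    shift-* : ∀ {d d′} c → Shift d d′ → Shift (λ γ η → c * d γ η) (λ γ η → c * d′ γ η)
    shift-* (+ m)      sd = shift-ℕ* m sd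
    shift-* {d} {d′} -[1+ m ] sd = shift-resp
      (λ γ η → ℤ.neg-distribˡ-* (+ suc m) (d γ η)) (λ γ η → ℤ.neg-distribˡ-* (+ suc m) (d′ γ η))
      (shift-neg (shift-ℕ* (suc m) sd))

    shift-sum : ∀ m {d d′ : Fin m → Elt σ} → (∀ i → Shift (d i) (d′ i)) →
                Shift (λ γ η → sumℤ m (λ i → d i γ η)) (λ γ η → sumℤ m (λ i → d′ i γ η))
    shift-sum zero    sd = shift-zero
    shift-sum (suc m) sd = shift-+ (sd zero) (shift-sum m (sd ∘ suc))

    shift-θ : ∀ i → Shift (λ γ η → θ γ i η) (λ γ η → θ⟨ 1 ⟩ γ i η)
    shift-θ i = shift λ x y e → ≋-trans
      (fibre-cong v₀ (≋-trans e (pointwise λ γ η → ≡⇒≡mod (cong (_+ x γ η) (θ≡θ⟨0⟩ γ i η)))))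
      (subst (λ u → fibre u ((λ γ η → θ⟨ 0 ⟩ γ i η) ⊕ x) ≋ (λ γ η → θ⟨ 1 ⟩ γ i η) ⊕ fibre v₀ x)
        (fundamentalPath-closed (proj₁ (h i)) (proj₂ (h i)))
        (fibre-path v₀ (rest (L i)) (L-inΓ i) x))

    -- If c θ vanishes, the translation it induces sends 0 to 0, so the companion combination of the
    -- voltages of the images, which is c S θ, fixes `fibre v₀ (zeroA σ)` and must vanish.
    kernel-invariant : ∀ c → InKernel primary θ c → InKernel primary θ (c ∙ S)
    kernel-invariant c c∈ker γ η = ≡mod-trans (∙S∙θ c γ η) (+-cancelˡ-mod (fibre v₀ (zeroA σ) γ η) (begin
      fibre v₀ (zeroA σ) γ η + (c ∙ θ⟨ 1 ⟩ γ) η   ≡⟨ ℤ.+-comm (fibre v₀ (zeroA σ) γ η) _ ⟩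
      (c ∙ θ⟨ 1 ⟩ γ) η + fibre v₀ (zeroA σ) γ η
        ≈⟨ at (shifts (shift-sum t (λ i → shift-* (c i) (shift-θ i))) (zeroA σ) (zeroA σ)
             (pointwise λ γ η → ≡mod-sym (≡mod-trans (≡⇒≡mod (ℤ.+-identityʳ _)) (c∈ker γ η)))) γ η ⟨
      fibre v₀ (zeroA σ) γ η                      ≡⟨ ℤ.+-identityʳ _ ⟨
      fibre v₀ (zeroA σ) γ η + 0ℤ                 ∎))
      where open ≡mod-Reasoning (p σ γ ^ k σ γ η)

  module ToLift (invariant : ∀ c → InKernel primary θ c → InKernel primary θ (c ∙ S)) where
    open Twist primary θ S invariant

    -- Tree arcs have voltage zero, but their images under `α` need not: `q u` is the displacement
    -- that the image of the tree path to `u` accumulates.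
    q : Fin n → Elt σ
    q u γ η = toTree (ν 1 γ η) u

    toTree+fromTree : ∀ r γ η u → toTree (ν r γ η) u + fromTree (ν r γ η) u ≡ 0ℤ [mod p σ γ ^ k σ γ η ]
    toTree+fromTree r γ η u = ≡mod-trans
      (≡⇒≡mod (sym (trans (pathSum-++ ψ v₀ (treePath v₀ u) (treePath u v₀))
        (cong (λ z → toTree ψ u + pathSum ψ z (treePath u v₀)) (treePath-last v₀ u)))))
      (closedTreeSum tree (ν-antisymmetric-tree r γ η) v₀ (treePath v₀ u ++ treePath u v₀)
        (subst (InGraph Tr) (sym arcs) (All.++⁺ (treePath-inTree v₀ u) (treePath-inTree u v₀)))
        (trans (lastV-++ v₀ (treePath v₀ u) (treePath u v₀))
               (trans (cong (λ z → lastV z (treePath u v₀)) (treePath-last v₀ u)) (treePath-last u v₀))))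
      where
      ψ = ν r γ η
      arcs : arcsFrom v₀ (treePath v₀ u ++ treePath u v₀) ≡
             arcsFrom v₀ (treePath v₀ u) ++ arcsFrom u (treePath u v₀)
      arcs = trans (arcsFrom-++ v₀ (treePath v₀ u) (treePath u v₀))
        (cong (λ z → arcsFrom v₀ (treePath v₀ u) ++ arcsFrom z (treePath u v₀)) (treePath-last v₀ u))

    -- The return part of the walk cancels against `q v`: out and back along the tree is a closed
    -- tree walk, on which the pulled-back voltages sum to zero.
    fundamentalPath-q : ∀ γ η u v →
      pathSum (ν 1 γ η) v₀ (fundamentalPath u v) + q v γ η ≡ ν 1 γ η u v + q u γ η [mod p σ γ ^ k σ γ η ]
    fundamentalPath-q γ η u v = begin
      pathSum ψ v₀ (fundamentalPath u v) + q v γ η        ≡⟨ cong (_+ q v γ η) (fundamentalPath-sum ψ u v) ⟩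
      q u γ η + (ψ u v + fromTree ψ v) + q v γ η          ≡⟨ lemma (q u γ η) (ψ u v) (fromTree ψ v) (q v γ η) ⟩
      ψ u v + q u γ η + (q v γ η + fromTree ψ v)
        ≈⟨ +-cong-mod (≡mod-refl {ψ u v + q u γ η}) (toTree+fromTree 1 γ η v) ⟩
      ψ u v + q u γ η + 0ℤ                                ≡⟨ ℤ.+-identityʳ _ ⟩
      ψ u v + q u γ η                                     ∎
      where
      open ≡mod-Reasoning (p σ γ ^ k σ γ η)
      ψ = ν 1 γ η
      lemma : ∀ a b c d → a + (b + c) + d ≡ b + a + (d + c)
      lemma = solve-∀

    θ-cotree : ∀ i γ η → θ γ i η ≡ vol φ (proj₁ (h i)) (proj₂ (h i)) γ η [mod p σ γ ^ k σ γ η ]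
    θ-cotree i γ η = begin
      θ γ i η                                 ≡⟨ θ≡θ⟨0⟩ γ i η ⟩
      θ⟨ 0 ⟩ γ i η                            ≡⟨ fundamentalPath-sum ψ u v ⟩
      toTree ψ u + (ψ u v + fromTree ψ v)
        ≈⟨ +-cong-mod (treeSum (treePath-inTree v₀ u))
                      (+-cong-mod (≡mod-refl {ψ u v}) (treeSum (treePath-inTree v v₀))) ⟩
      0ℤ + (ψ u v + 0ℤ)                       ≡⟨ trans (ℤ.+-identityˡ _) (ℤ.+-identityʳ _) ⟩
      ψ u v                                   ∎
      where
      open ≡mod-Reasoning (p σ γ ^ k σ γ η)
      u = proj₁ (h i)
      v = proj₂ (h i)
      ψ = ν 0 γ η
      treeSum : ∀ {es} → InGraph Tr es → arcSum ψ es ≡ 0ℤ [mod p σ γ ^ k σ γ η ]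
      treeSum = arcSum-zero λ u v e → congruent (φ-reduced u v e γ η)

    -- With the voltage of (u,v) written as c θ, the second component is the condition under which
    -- the map sending (u,x) to (α u, twist x + q u) preserves the edges above this arc.
    ArcCoordinates : Fin n → Fin n → (Fin t → ℤ) → Set
    ArcCoordinates u v c = vol φ u v ≋ combination θ c ×
      (combination θ (c ∙ S) ⊕ q v ≋ vol φ (α̂ u) (α̂ v) ⊕ q u)

    arcCoordinates-tree : ∀ u v → Tr u v ≡ true → ArcCoordinates u v (λ _ → 0ℤ)
    arcCoordinates-tree u v e =
      pointwise (λ γ η → ≡mod-trans (congruent (φ-reduced u v e γ η)) (≡⇒≡mod (sym (∙-zeroˡ (θ γ) η)))) ,
      pointwise λ γ η → let open ≡mod-Reasoning (p σ γ ^ k σ γ η) in begin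
        ((λ _ → 0ℤ) ∙ S ∙ θ γ) η + q v γ η
          ≡⟨ cong (_+ q v γ η) (trans (∙-congˡ (θ γ) (∙-zeroˡ S) η) (∙-zeroˡ (θ γ) η)) ⟩
        0ℤ + q v γ η
          ≈⟨ +-cong-mod (closed γ η) (≡mod-refl {q v γ η}) ⟨
        pathSum (ν 1 γ η) v₀ (fundamentalPath u v) + q v γ η      ≈⟨ fundamentalPath-q γ η u v ⟩
        ν 1 γ η u v + q u γ η                                     ∎
      where
      closed : ∀ γ η → pathSum (ν 1 γ η) v₀ (fundamentalPath u v) ≡ 0ℤ [mod p σ γ ^ k σ γ η ]
      -- For a tree arc the whole fundamental walk stays in the tree, which matches the coefficient
      -- vector 0.
      closed γ η = closedTreeSum tree (ν-antisymmetric-tree 1 γ η) v₀ (fundamentalPath u v)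
        (subst (InGraph Tr) (sym (fundamentalPath-arcs u v))
          (All.++⁺ (treePath-inTree v₀ u) (e ∷ treePath-inTree v v₀)))
        (fundamentalPath-closed u v)

    unit∙ : ∀ z i γ η → (unit z i ∙ θ γ) η ≡ z * vol φ (proj₁ (h i)) (proj₂ (h i)) γ η [mod p σ γ ^ k σ γ η ]
    unit∙ z i γ η = ≡mod-trans (≡⇒≡mod (∙-unit z i (θ γ) η)) (*-congˡ-mod z (θ-cotree i γ η))

    unit∙S : ∀ z i γ η → (unit z i ∙ S ∙ θ γ) η ≡ z * θ⟨ 1 ⟩ γ i η [mod p σ γ ^ k σ γ η ]
    unit∙S z i γ η = ≡mod-trans (∙S∙θ (unit z i) γ η) (≡⇒≡mod (∙-unit z i (θ⟨ 1 ⟩ γ) η))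

    arcCoordinates-cotree : ∀ i → ArcCoordinates (proj₁ (h i)) (proj₂ (h i)) (unit 1ℤ i)
    arcCoordinates-cotree i =
      pointwise (λ γ η → ≡mod-sym (≡mod-trans (unit∙ 1ℤ i γ η) (≡⇒≡mod (ℤ.*-identityˡ _)))) ,
      pointwise (λ γ η → ≡mod-trans
        (+-cong-mod (≡mod-trans (unit∙S 1ℤ i γ η) (≡⇒≡mod (ℤ.*-identityˡ _)))
                    (≡mod-refl {q (proj₂ (h i)) γ η}))
        (fundamentalPath-q γ η (proj₁ (h i)) (proj₂ (h i))))

    -- With Θ the voltage of the image of `L i`, the chosen arc gives Θ + q v = ν(u,v) + q u;
    -- negated and rearranged, this is the identity for the opposite arc.
    arcCoordinates-opposite : ∀ i → ArcCoordinates (proj₂ (h i)) (proj₁ (h i)) (unit (- 1ℤ) i)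
    arcCoordinates-opposite i =
      pointwise (λ γ η → ≡mod-trans (ν-antisymmetric 0 γ η u v e) (≡mod-sym
        (≡mod-trans (unit∙ (- 1ℤ) i γ η) (≡⇒≡mod (ℤ.-1*i≡-i _))))) ,
      pointwise λ γ η → let open ≡mod-Reasoning (p σ γ ^ k σ γ η) ; Θ = θ⟨ 1 ⟩ γ i η in begin
        (unit (- 1ℤ) i ∙ S ∙ θ γ) η + q u γ η
          ≈⟨ +-cong-mod (≡mod-trans (unit∙S (- 1ℤ) i γ η) (≡⇒≡mod (ℤ.-1*i≡-i Θ))) (≡mod-refl {q u γ η}) ⟩
        - Θ + q u γ η                                          ≡⟨ lemma Θ (q u γ η) (ν 1 γ η u v) ⟩
        - Θ + - ν 1 γ η u v + (ν 1 γ η u v + q u γ η)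
          ≈⟨ +-cong-mod (≡mod-refl { - Θ + - ν 1 γ η u v}) (fundamentalPath-q γ η u v) ⟨
        - Θ + - ν 1 γ η u v + (Θ + q v γ η)                    ≡⟨ lemma′ Θ (ν 1 γ η u v) (q v γ η) ⟩
        - ν 1 γ η u v + q v γ η
          ≈⟨ +-cong-mod (ν-antisymmetric 1 γ η u v e) (≡mod-refl {q v γ η}) ⟨
        ν 1 γ η v u + q v γ η                                  ∎
      where
      u = proj₁ (h i)
      v = proj₂ (h i)
      e = IsCotreeArcs.isEdge cotree i
      lemma : ∀ a b c → - a + b ≡ - a + - c + (c + b)
      lemma = solve-∀
      lemma′ : ∀ a c b → - a + - c + (a + b) ≡ - c + b
      lemma′ = solve-∀

    arcCoordinates : ∀ u v → Adj Γ u v ≡ true → ∃ (ArcCoordinates u v)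
    arcCoordinates u v e with Tr u v in tr
    ... | true  = (λ _ → 0ℤ) , arcCoordinates-tree u v tr
    ... | false with IsCotreeArcs.covers cotree u v e tr
    ...   | i , inj₁ h≡ = unit 1ℤ i ,
      subst (λ a → ArcCoordinates (proj₁ a) (proj₂ a) (unit 1ℤ i)) h≡ (arcCoordinates-cotree i)
    ...   | i , inj₂ h≡ = unit (- 1ℤ) i ,
      subst (λ a → ArcCoordinates (proj₂ a) (proj₁ a) (unit (- 1ℤ) i)) h≡ (arcCoordinates-opposite i)

    lift : Lifts Γ φ α
    lift = record
      { f        = to
      ; f⁻¹      = from
      ; f-cong   = to-cong
      ; f⁻¹-cong = from-cong
      ; invˡ     = λ (u , x) → inverseˡ α , ≋⇒EqA (from-to u x)
      ; invʳ     = λ (v , y) → inverseʳ α , ≋⇒EqA (to-from v y)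
      ; adj⇒     = λ (u , x) (v , y) (e , y≡) →
                     trans (α-aut u v) e , ≋⇒EqA (arc⇒ u v e x y (EqA⇒≋ {y} {vol φ u v ⊕ x} y≡))
      ; adj⇐     = λ (u , x) (v , y) (e , y≡) → let e′ = trans (sym (α-aut u v)) e in
                     e′ ,
                     ≋⇒EqA (arc⇐ u v e′ x y (EqA⇒≋ {twist y ⊕ q v} {vol φ (α̂ u) (α̂ v) ⊕ (twist x ⊕ q u)} y≡))
      } , λ _ → refl
      where
      -- As `twist` has period `suc r₀`, its `r₀`-th iterate is its inverse. The correction is
      -- removed first, at the vertex of the source fibre.
      from-twist : Fin n → Elt σ → Elt σ
      from-twist u y = iterate twist (y ⊕ negA σ (q u)) r₀

      to from : Fin n × Elt σ → Fin n × Elt σ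
      to   (u , x) = α̂ u , twist x ⊕ q u
      from (v , y) = α ⟨$⟩ˡ v , from-twist (α ⟨$⟩ˡ v) y

      ⊕-congʳ : ∀ d {x y} → x ≋ y → x ⊕ d ≋ y ⊕ d
      ⊕-congʳ d e = pointwise λ γ η → +-cong-mod (at e γ η) (≡mod-refl {d γ η})

      add-sub : ∀ x y → x + y - y ≡ x
      add-sub = solve-∀

      sub-add : ∀ x y → x - y + y ≡ x
      sub-add = solve-∀

      twist-twist⁻¹ : ∀ x → twist (iterate twist x r₀) ≋ x
      twist-twist⁻¹ x = subst (_≋ x) (sym (iterate-suc twist x r₀)) (twist-periodic r₀ S-periodic x)

      to-cong : ∀ x y → EqV σ x y → EqV σ (to x) (to y)
      to-cong (u , x) (.u , y) (refl , e) = refl , ≋⇒EqA (⊕-congʳ (q u) (twist-cong {x} {y} (EqA⇒≋ e)))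

      from-cong : ∀ x y → EqV σ x y → EqV σ (from x) (from y)
      from-cong (v , x) (.v , y) (refl , e) = refl ,
        ≋⇒EqA (iterate-twist-cong r₀ (⊕-congʳ (negA σ (q (α ⟨$⟩ˡ v))) {x} {y} (EqA⇒≋ e)))

      from-to : ∀ u x → from-twist (α ⟨$⟩ˡ α̂ u) (twist x ⊕ q u) ≋ x
      from-to u x = ≋-trans (iterate-twist-cong r₀ {_} {twist x} (pointwise λ γ η → ≡⇒≡mod
          (trans (cong (λ v → twist x γ η + q u γ η - q v γ η) (inverseˡ α))
            (add-sub (twist x γ η) (q u γ η)))))
        (twist-periodic r₀ S-periodic x)

      to-from : ∀ v y → twist (from-twist (α ⟨$⟩ˡ v) y) ⊕ q (α ⟨$⟩ˡ v) ≋ y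
      to-from v y = ≋-trans (⊕-congʳ (q (α ⟨$⟩ˡ v)) (twist-twist⁻¹ (y ⊕ negA σ (q (α ⟨$⟩ˡ v)))))
        (pointwise λ γ η → ≡⇒≡mod (sub-add (y γ η) (q (α ⟨$⟩ˡ v) γ η)))

      module _ (u v : Fin n) (e : Adj Γ u v ≡ true) (x y : Elt σ) where
        private
          c = proj₁ (arcCoordinates u v e)

          vol⊕x : vol φ u v ⊕ x ≋ x ⊕ combination θ c
          vol⊕x = pointwise λ γ η → ≡mod-trans (≡⇒≡mod (ℤ.+-comm (vol φ u v γ η) (x γ η)))
            (+-cong-mod (≡mod-refl {x γ η}) (at (proj₁ (proj₂ (arcCoordinates u v e))) γ η))

          image : twist x ⊕ combination θ (c ∙ S) ⊕ q v ≋ vol φ (α̂ u) (α̂ v) ⊕ (twist x ⊕ q u)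
          image = pointwise λ γ η → let open ≡mod-Reasoning (p σ γ ^ k σ γ η) in begin
            twist x γ η + (c ∙ S ∙ θ γ) η + q v γ η       ≡⟨ ℤ.+-assoc (twist x γ η) _ _ ⟩
            twist x γ η + ((c ∙ S ∙ θ γ) η + q v γ η)
              ≈⟨ +-cong-mod (≡mod-refl {twist x γ η}) (at (proj₂ (proj₂ (arcCoordinates u v e))) γ η) ⟩
            twist x γ η + (ν 1 γ η u v + q u γ η)         ≡⟨ lemma (twist x γ η) (ν 1 γ η u v) (q u γ η) ⟩
            ν 1 γ η u v + (twist x γ η + q u γ η)         ∎
            where
            lemma : ∀ a b c → a + (b + c) ≡ b + (a + c)
            lemma = solve-∀

        arc⇒ : y ≋ vol φ u v ⊕ x → twist y ⊕ q v ≋ vol φ (α̂ u) (α̂ v) ⊕ (twist x ⊕ q u)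
        arc⇒ y≋ = ≋-trans (⊕-congʳ (q v) (twist-⊕ y x c (≋-trans y≋ vol⊕x))) image

        arc⇐ : twist y ⊕ q v ≋ vol φ (α̂ u) (α̂ v) ⊕ (twist x ⊕ q u) → y ≋ vol φ u v ⊕ x
        -- Cancelling `q v` shows that `y` and x + c θ have congruent images under `twist`, which is
        -- injective by periodicity.
        arc⇐ image≋ = ≋-trans (twist-injective r₀ S-periodic (≋-trans
          (pointwise λ γ η → +-cancelˡ-mod (q v γ η) (≡mod-trans (≡⇒≡mod (ℤ.+-comm (q v γ η) _))
            (≡mod-trans (at (≋-trans image≋ (≋-sym image)) γ η) (≡⇒≡mod (ℤ.+-comm _ (q v γ η))))))
          (≋-sym (twist-⊕ (x ⊕ combination θ c) x c ≋-refl)))) (≋-sym vol⊕x)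

theorem3p5 : ∀ {n : ℕ} (Γ : Graph n) (Tr : Fin n → Fin n → Bool) → IsSpanningTree Γ Tr →
    ∀ (v₀ : Fin n) (W : Fin n → Fin n → Walk n) → (∀ x y → IsTreeWalk Tr x y (W x y)) →
    ∀ (t : ℕ) (h : Fin t → Fin n × Fin n) → IsCotreeArcs Γ Tr h →
    ∀ (σ : Shape) → IsPrimaryShape σ →
    ∀ (φ : Voltage n σ) → IsVoltage Γ φ → IsTReduced Tr φ →
    ∀ (α : Permutation′ n) → IsAut Γ α →
    ∀ (S : Mat t t) → IsHomologyMatrix α (basicWalk v₀ W h) S →
    ∀ (Q Q⁻¹ : (γ : Fin (g σ)) → Mat t t)
    (T T⁻¹ : (γ : Fin (g σ)) → Mat (suc (a σ γ)) (suc (a σ γ))) →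
    (∀ γ → IsInvPair (p σ γ ^ Kγ σ γ) t (Q γ) (Q⁻¹ γ)) →
    (∀ γ → IsInvPair (p σ γ ^ Kγ σ γ) (suc (a σ γ)) (T γ) (T⁻¹ γ)) →
    ∀ (s : (γ : Fin (g σ)) → Fin t → ℕ) →
    (∀ γ → IsNormalForm (p σ γ) (Kγ σ γ) t (suc (a σ γ))
    ((Q γ · Bmat σ φ (basicWalk v₀ W h) γ) · T γ) (s γ)) →
    (Lifts Γ φ α ⇔
    (∀ γ (i j : Fin t) → toℕ j < toℕ i →
    s γ i ∸ s γ j ≤ dp (p σ γ) (Kγ σ γ) (((Q γ · S) · Q⁻¹ γ) i j)))
theorem3p5 Γ Tr tree v₀ W W-tree t h cotree σ primary φ φ-voltage φ-reduced α α-aut S S-homology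
           Q Q⁻¹ T T⁻¹ QQ⁻¹ TT⁻¹ s nf = mk⇔
  (λ lift γ → Equivalence.to (local γ) (Equivalence.to global (FromLift.kernel-invariant lift) γ))
  (λ le → ToLift.lift (Equivalence.from global λ γ → Equivalence.from (local γ) (le γ)))
  where
  open Lifting tree v₀ W W-tree h cotree primary φ φ-voltage φ-reduced α α-aut S S-homology
  B = Bmat σ φ L
  global = kernel-localisation primary θ S
  local : ∀ γ → KernelInvariant (p σ γ ^ Kγ σ γ) (B γ) S ⇔
                (∀ i j → toℕ j < toℕ i → s γ i ∸ s γ j ≤ dp (p σ γ) (Kγ σ γ) (((Q γ · S) · Q⁻¹ γ) i j))
  local γ = mk⇔
    (Equivalence.to criterion ∘ Equivalence.to change)
    (Equivalence.from change ∘ Equivalence.from criterion)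
    where
    instance _ = prime⇒nonZero (IsPrimaryShape.prime primary γ)
    change = kernelInvariant-equiv (Q γ) (Q⁻¹ γ) (T γ) (T⁻¹ γ) (QQ⁻¹ γ) (TT⁻¹ γ) (B γ) S
    criterion = normalForm-criterion ((Q γ · B γ) · T γ) (nf γ) ((Q γ · S) · Q⁻¹ γ)
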